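{- Let $k\geq 2$ and let $n,r$ be positive integers with $1<r<\frac{(k-1)n}{k}$. Let $\mathcal{F}\subseteq\binom{[n]}{r}$ be a $k$-wise intersecting family. Then for any $0\leq\epsilon<1$ there exists $0\leq\delta<1$ (in particular, any $\delta\leq\frac{\epsilon}{rn^4}$ suffices) such that if $|\mathcal{F}|\geq(1-\delta)\binom{n-1}{r-1}$, then there is an element $v\in[n]$ such that $|\mathcal{F}(v)|\geq(1-\epsilon/n)\binom{n-1}{r-1}$.
   Context: $[n]=\{1,\dots,n\}$ and $\binom{[n]}{r}$ is the family of all $r$-element subsets of $[n]$. A family $\mathcal{F}\subseteq\binom{[n]}{r}$ is $k$-wise intersecting if $F_1\cap\cdots\cap F_k\neq\emptyset$ for all $F_1,\dots,F_k\in\mathcal{F}$. For $v\in[n]$, $\mathcal{F}(v)=\{F\in\mathcal{F}: v\in F\}$.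
   Formalization: The parameters ε and δ range over rational numbers rather than real numbers; everything else is as stated. -}

module Defs where

open import Data.Nat using (ℕ; zero; suc)
open import Data.Integer using (+_)
open import Data.Rational using (ℚ; _/_; _*_; 0ℚ)
open import Data.Fin using (Fin)
open import Data.Fin.Subset using (Subset; ∣_∣) renaming (_∈_ to _∈ₛ_)
open import Data.Fin.Subset.Properties using (_∈?_)
open import Data.List using (List; length; filter)
open import Data.List.Membership.Propositional renaming (_∈_ to _∈ₗ_)
open import Data.List.Relation.Unary.All using (All)
open import Data.List.Relation.Unary.Unique.Propositional using (Unique)
open import Data.Product using (∃; _×_)
open import Relation.Binary.PropositionalEquality using (_≡_)

IsUniformFamily : (n r : ℕ) → List (Subset n) → Set
IsUniformFamily n r 𝓕 = Unique 𝓕 × All (λ F → ∣ F ∣ ≡ r) 𝓕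

KWiseIntersecting : {n : ℕ} → ℕ → List (Subset n) → Set
KWiseIntersecting {n} k 𝓕 =
  (G : Fin k → Subset n) → (∀ i → G i ∈ₗ 𝓕) → ∃ λ (v : Fin n) → ∀ i → v ∈ₛ G i

star : {n : ℕ} → List (Subset n) → Fin n → List (Subset n)
star 𝓕 v = filter (v ∈?_) 𝓕

ℕtoℚ : ℕ → ℚ
ℕtoℚ m = + m / 1

-- division of a rational by a natural number (junk value 0 when dividing by 0;
-- only used with positive divisors)
_/ℕ_ : ℚ → ℕ → ℚ
q /ℕ zero = 0ℚ
q /ℕ suc m = q * (+ 1 / suc m)

{-# OPTIONS --safe #-}
module Submission where

-- Katona's cycle method with a count of the exceptional orderings. On a cyclic ordering of [n] at
-- most r of the n arcs of length r belong to 𝓕: splitting the positions into residue classes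
-- modulo m = n − r, a missing arc is forced in every class, since otherwise k complements of
-- members, which are arcs of length m with k m > n, would cover the cycle. If r arcs occur, then
-- they are the arcs through a single point v, and this persists when two neighbours other than v
-- are transposed, unless fewer than r arcs occur in the new ordering. Any two orderings with v in
-- first position are joined by at most n²/2 such transpositions, so if 𝓕 is nearly as large as a
-- star, then a v that is the centre of a fair share of the orderings is the centre of almost all.
-- Counting the arcs through v then bounds the number of members of 𝓕 that contain v.

open import Defs
open import Data.Nat using (ℕ; suc) renaming (_*_ to _*ℕ_; _<_ to _<ℕ_; _≤_ to _≤ℕ_; _∸_ to _∸ℕ_; _^_ to _^ℕ_)
open import Data.Nat.Combinatorics using (_C_)
open import Data.Fin using (Fin)
open import Data.Fin.Subset using (Subset)
open import Data.List using (List; length)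
open import Data.Product using (Σ; ∃; _×_)

-- The constant r n⁴ collects the losses of the argument. Let D be the deficiency of 𝓕 against the
-- full star and K = m! r!. An ordering with fewer than r arcs wastes at least one, so at most K D
-- of the orderings with a fixed first entry are of this kind. There are n candidates for the
-- centre, so the best one is only known to own a share of 1/(2n); separating its orderings from the
-- rest along paths of length n²/2 shows that at most n³ K D orderings starting with v have another
-- centre or none. Each of them costs at most r arcs, so 𝓕(v) falls short of the full star by at
-- most r n³ D, and the fourth factor n is the one in ε/n. The obstacle on a single cycle is the
-- equality case. One missing arc per residue class gives the bound r but says nothing about where
-- the missing arcs lie; paths that change from one residue class to the adjacent one are what makes
-- them consecutive.

module Cycles where

  open import Data.Bool using (Bool; true; false; not; _∧_)
  import Data.Bool.Properties as Bool
  open import Data.Empty using (⊥; ⊥-elim)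
  open import Data.Fin using (toℕ; fromℕ<) renaming (zero to fzero; suc to fsuc; _≟_ to _≟ᶠ_)
  open import Data.Fin.Properties using (toℕ-fromℕ<)
  open import Data.Fin.Subset using (_∪_; ⁅_⁆; ∣_∣; ∁) renaming (_∈_ to _∈ₛ_; ⊥ to ∅)
  open import Data.Fin.Subset.Properties using (_∈?_; x∈p∪q⁻; x∈p∪q⁺; x∈⁅x⁆; x∈⁅y⁆⇒x≡y; ∉⊥; ⊆-antisym)
  open import Data.List using ([]; _∷_; _++_; map; drop; allFin; tabulate)
  open import Data.List.Properties using (length-++; length-map; length-tabulate; map-++; map-tabulate; ++-identityʳ; ++-assoc)
  import Data.List.Membership.DecPropositional as DecMembership
  open import Data.List.Membership.Propositional using () renaming (_∈_ to _∈ₗ_)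
  open import Data.List.Membership.Propositional.Properties using (∈-allFin; ∈-filter⁺; ∈-filter⁻; ∈-∃++; ∈-map⁺; ∈-map⁻)
  import Data.List.Relation.Binary.Permutation.Propositional as ↭
  open import Data.List.Relation.Binary.Permutation.Propositional using (_↭_; prep; swap; ↭-trans; ↭-sym; ↭-refl; ↭⇒↭ₛ)
  open import Data.List.Relation.Binary.Permutation.Propositional.Properties using (↭-length; ∷↭∷ʳ; ∈-resp-↭; shift; map⁺; ++⁺ʳ; ++⁺ˡ)
  import Data.List.Relation.Binary.Permutation.Setoid.Properties as SetoidPermutation
  import Data.List.Relation.Unary.All as All
  open import Data.List.Relation.Unary.All using (All; []; _∷_)
  import Data.List.Relation.Unary.All.Properties as AllP
  open import Data.List.Relation.Unary.AllPairs using ([]; _∷_)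
  open import Data.List.Relation.Unary.Any using (here; there)
  open import Data.List.Relation.Unary.Unique.Propositional using (Unique)
  open import Data.List.Relation.Unary.Unique.Propositional.Properties using (allFin⁺; filter⁺; Unique[x∷xs]⇒x∉xs)
  open import Data.Nat using (zero; _+_; _*_; _∸_; _⊓_; _/_; _%_; _!; _≤_; _<_; z≤n; s≤s; _≤?_; _<?_; NonZero; >-nonZero)
  open import Data.Nat.Combinatorics using (nCk≡n!/k![n-k]!; k![n∸k]!∣n!)
  open import Data.Nat.DivMod using (m≡m%n+[m/n]*n; m%n<n; m/n*n≡m)
  open import Data.Nat.Properties
  open import Data.Nat.Tactic.RingSolver using (solve-∀)
  open import Data.Product using (_,_; proj₁; proj₂)
  open import Data.Sum using (_⊎_; inj₁; inj₂)
  open import Data.Vec using ([]; _∷_; here; there)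
  open import Data.Vec.Properties using (≡-dec)
  open import Function using (_∘_)
  open import Relation.Binary.Definitions using (tri<; tri≈; tri>)
  open import Relation.Binary.PropositionalEquality using (_≡_; _≢_; refl; sym; trans; cong; cong₂; subst; setoid; module ≡-Reasoning)
  open import Relation.Nullary using (¬_; Dec; yes; no; does; contradiction)
  open import Relation.Nullary.Decidable using (dec-true; dec-false)

  private variable
    A B : Set

  -- Sums

  +-interchange : ∀ a b c d → (a + b) + (c + d) ≡ (a + c) + (b + d)
  +-interchange = solve-∀

  +-swap : ∀ a b c → a + (b + c) ≡ b + (a + c)
  +-swap = solve-∀

  Σ< : ℕ → (ℕ → ℕ) → ℕ
  Σ< zero    f = 0
  Σ< (suc n) f = f 0 + Σ< n (f ∘ suc)

  Σ<-cong : ∀ n {f g : ℕ → ℕ} → (∀ i → i < n → f i ≡ g i) → Σ< n f ≡ Σ< n g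
  Σ<-cong zero    h = refl
  Σ<-cong (suc n) h = cong₂ _+_ (h 0 (s≤s z≤n)) (Σ<-cong n λ i i<n → h (suc i) (s≤s i<n))

  Σ<-mono : ∀ n {f g : ℕ → ℕ} → (∀ i → i < n → f i ≤ g i) → Σ< n f ≤ Σ< n g
  Σ<-mono zero    h = z≤n
  Σ<-mono (suc n) h = +-mono-≤ (h 0 (s≤s z≤n)) (Σ<-mono n λ i i<n → h (suc i) (s≤s i<n))

  Σ<-+ : ∀ n (f g : ℕ → ℕ) → Σ< n (λ i → f i + g i) ≡ Σ< n f + Σ< n g
  Σ<-+ zero    f g = refl
  Σ<-+ (suc n) f g = trans (cong (f 0 + g 0 +_) (Σ<-+ n (f ∘ suc) (g ∘ suc)))
    (+-interchange (f 0) (g 0) (Σ< n (f ∘ suc)) (Σ< n (g ∘ suc)))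

  Σ<-const : ∀ n c → Σ< n (λ _ → c) ≡ n * c
  Σ<-const zero    c = refl
  Σ<-const (suc n) c = cong (c +_) (Σ<-const n c)

  Σ<-split : ∀ a b (f : ℕ → ℕ) → Σ< (a + b) f ≡ Σ< a f + Σ< b (λ i → f (a + i))
  Σ<-split zero    b f = refl
  Σ<-split (suc a) b f = trans (cong (f 0 +_) (Σ<-split a b (f ∘ suc))) (sym (+-assoc (f 0) _ _))

  Σ<-last : ∀ n (f : ℕ → ℕ) → Σ< (suc n) f ≡ Σ< n f + f n
  Σ<-last zero    f = +-comm (f 0) 0
  Σ<-last (suc n) f = trans (cong (f 0 +_) (Σ<-last n (f ∘ suc))) (sym (+-assoc (f 0) _ _))

  Σ<-shift : ∀ n (f : ℕ → ℕ) → f n ≡ f 0 → Σ< n (f ∘ suc) ≡ Σ< n f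
  Σ<-shift n f e = +-cancelˡ-≡ (f 0) _ _ (trans (Σ<-last n f) (trans (cong (Σ< n f +_) e) (+-comm (Σ< n f) (f 0))))

  Σ<-comm : ∀ a b (f : ℕ → ℕ → ℕ) → Σ< a (λ i → Σ< b (f i)) ≡ Σ< b (λ j → Σ< a (λ i → f i j))
  Σ<-comm zero    b f = sym (trans (Σ<-const b 0) (*-zeroʳ b))
  Σ<-comm (suc a) b f = trans (cong (Σ< b (f 0) +_) (Σ<-comm a b (f ∘ suc)))
    (sym (Σ<-+ b (f 0) (λ j → Σ< a (λ i → f (suc i) j))))

  Σ<-block : ∀ k m (f : ℕ → ℕ) → Σ< (k * m) f ≡ Σ< k (λ i → Σ< m (λ j → f (i * m + j)))
  Σ<-block zero    m f = refl
  Σ<-block (suc k) m f = trans (Σ<-split m (k * m) f) (cong (Σ< m f +_)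
    (trans (Σ<-block k m (f ∘ (m +_)))
      (Σ<-cong k λ i _ → Σ<-cong m λ j _ → cong f (sym (+-assoc m (i * m) j)))))

  Σ<-term : ∀ n (f : ℕ → ℕ) {i} → i < n → f i ≤ Σ< n f
  Σ<-term (suc n) f {zero}  _         = m≤m+n (f 0) _
  Σ<-term (suc n) f {suc i} (s≤s i<n) = ≤-trans (Σ<-term n (f ∘ suc) i<n) (m≤n+m _ (f 0))

  Σ<-two-terms : ∀ n (f : ℕ → ℕ) {i j} → i < j → j < n → f i + f j ≤ Σ< n f
  Σ<-two-terms (suc n) f {zero}  {suc j} _         (s≤s j<n) = +-monoʳ-≤ (f 0) (Σ<-term n (f ∘ suc) j<n)
  Σ<-two-terms (suc n) f {suc i} {suc j} (s≤s i<j) (s≤s j<n) =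
    ≤-trans (Σ<-two-terms n (f ∘ suc) i<j j<n) (m≤n+m _ (f 0))

  -- Slack in a single term would make the inequality between the sums strict. This is the equality
  -- case behind both the residue classes and the arcs through a centre.
  Σ<-tight : ∀ n {f g : ℕ → ℕ} → (∀ i → i < n → f i ≤ g i) → Σ< n g ≤ Σ< n f → ∀ {i} → i < n → g i ≤ f i
  Σ<-tight (suc n) {f} {g} h le {zero} _ = +-cancelʳ-≤ (Σ< n (f ∘ suc)) (g 0) (f 0)
    (≤-trans (+-monoʳ-≤ (g 0) (Σ<-mono n λ i i<n → h (suc i) (s≤s i<n))) le)
  Σ<-tight (suc n) {f} {g} h le {suc i} (s≤s i<n) = Σ<-tight n {f ∘ suc} {g ∘ suc}
    (λ i i<n → h (suc i) (s≤s i<n))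
    (+-cancelˡ-≤ (f 0) _ _ (≤-trans (+-monoˡ-≤ (Σ< n (g ∘ suc)) (h 0 (s≤s z≤n))) le)) i<n

  Σₗ : List A → (A → ℕ) → ℕ
  Σₗ []       f = 0
  Σₗ (x ∷ xs) f = f x + Σₗ xs f

  Σₗ-↭ : ∀ {xs ys : List A} → xs ↭ ys → (f : A → ℕ) → Σₗ xs f ≡ Σₗ ys f
  Σₗ-↭ ↭.refl        f = refl
  Σₗ-↭ (prep x p)    f = cong (f x +_) (Σₗ-↭ p f)
  Σₗ-↭ (swap x y p)  f = trans (cong (λ s → f x + (f y + s)) (Σₗ-↭ p f)) (+-swap (f x) (f y) _)
  Σₗ-↭ (↭.trans p q) f = trans (Σₗ-↭ p f) (Σₗ-↭ q f)

  ≤-max-term : ∀ (x : A) xs (f : A → ℕ) → ∃ λ v → Σₗ (x ∷ xs) f ≤ length (x ∷ xs) * f v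
  ≤-max-term x []       f = x , ≤-refl
  ≤-max-term x (y ∷ xs) f with ≤-max-term y xs f
  ... | v , le with ≤-total (f x) (f v)
  ... | inj₁ fx≤fv = v , +-mono-≤ fx≤fv le
  ... | inj₂ fv≤fx = x , +-monoʳ-≤ (f x) (≤-trans le (*-monoʳ-≤ (length (y ∷ xs)) fv≤fx))

  -- Sums over permutations

  -- One stage in the enumeration of permutations: the entry that comes first, together with the
  -- list left over. Summing by recursion on this, without listing permutations, turns invariance
  -- statements into exchanges of sums.
  sel : (A → List A → ℕ) → List A → ℕ
  sel h []       = 0
  sel h (x ∷ xs) = h x xs + sel (λ y ys → h y (x ∷ ys)) xs

  -- Sums g over all permutations of xs, provided that xs has length n.
  perm∑ : ℕ → (List A → ℕ) → List A → ℕ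
  perm∑ zero    g xs = g []
  perm∑ (suc n) g xs = sel (λ y ys → perm∑ n (g ∘ (y ∷_)) ys) xs

  sel-cong : ∀ {h h′ : A → List A → ℕ} xs → (∀ y ys → y ∷ ys ↭ xs → h y ys ≡ h′ y ys) → sel h xs ≡ sel h′ xs
  sel-cong []       e = refl
  sel-cong (x ∷ xs) e = cong₂ _+_ (e x xs ↭-refl)
    (sel-cong xs λ y ys p → e y (x ∷ ys) (↭-trans (swap y x ↭-refl) (prep x p)))

  sel-+ : ∀ (h h′ : A → List A → ℕ) xs → sel (λ y ys → h y ys + h′ y ys) xs ≡ sel h xs + sel h′ xs
  sel-+ h h′ []       = refl
  sel-+ h h′ (x ∷ xs) = trans (cong (h x xs + h′ x xs +_) (sel-+ _ _ xs)) (+-interchange (h x xs) (h′ x xs) _ _)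

  sel-const : ∀ c (xs : List A) → sel (λ _ _ → c) xs ≡ length xs * c
  sel-const c []       = refl
  sel-const c (x ∷ xs) = cong (c +_) (sel-const c xs)

  sel-++ : ∀ (h : A → List A → ℕ) xs zs →
    sel h (xs ++ zs) ≡ sel (λ y ys → h y (ys ++ zs)) xs + sel (λ y ys → h y (xs ++ ys)) zs
  sel-++ h []       zs = refl
  sel-++ h (x ∷ xs) zs = trans (cong (h x (xs ++ zs) +_) (sel-++ (λ y ys → h y (x ∷ ys)) xs zs))
    (sym (+-assoc (h x (xs ++ zs)) _ _))

  sel-↭ : ∀ (h : A → List A → ℕ) → (∀ y {ys zs} → ys ↭ zs → h y ys ≡ h y zs) →
    ∀ {xs xs′} → xs ↭ xs′ → sel h xs ≡ sel h xs′
  sel-↭ h e ↭.refl       = refl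
  sel-↭ h e (prep x p)   = cong₂ _+_ (e x p) (sel-↭ _ (λ y q → e y (prep x q)) p)
  sel-↭ h e (swap {xs} {xs′} x y p) = begin
    h x (y ∷ xs) + (h y (x ∷ xs) + sel (λ z zs → h z (x ∷ y ∷ zs)) xs)
      ≡⟨ cong₂ _+_ (e x (prep y p)) (cong₂ _+_ (e y (prep x p))
          (trans (sel-cong xs (λ z zs _ → e z (swap x y ↭-refl))) (sel-↭ _ (λ z q → e z (prep y (prep x q))) p))) ⟩
    h x (y ∷ xs′) + (h y (x ∷ xs′) + s)
      ≡⟨ +-swap (h x (y ∷ xs′)) (h y (x ∷ xs′)) s ⟩
    h y (x ∷ xs′) + (h x (y ∷ xs′) + s) ∎
    where
    open ≡-Reasoning
    s = sel (λ z zs → h z (y ∷ x ∷ zs)) xs′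
  sel-↭ h e (↭.trans p q) = trans (sel-↭ h e p) (sel-↭ h e q)

  -- Both sides run over ordered pairs of picked entries, with the roles of the two picks exchanged.
  -- This is the whole content of `perm∑-swapAt` at the front.
  sel-comm : ∀ (K : A → A → List A → ℕ) xs → sel (λ y → sel (K y)) xs ≡ sel (λ y → sel (λ z → K z y)) xs
  sel-comm K []       = refl
  sel-comm K (x ∷ xs) = begin
    a + sel (λ y ys → K y x ys + sel (λ z zs → K y z (x ∷ zs)) ys) xs
      ≡⟨ cong (a +_) (sel-+ (λ y → K y x) _ xs) ⟩
    a + (b + c)
      ≡⟨ sym (+-assoc a b c) ⟩
    a + b + c
      ≡⟨ cong₂ _+_ (+-comm a b) (sel-comm (λ y z zs → K y z (x ∷ zs)) xs) ⟩
    b + a + d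
      ≡⟨ +-assoc b a d ⟩
    b + (a + d)
      ≡⟨ cong (b +_) (sym (sel-+ (K x) _ xs)) ⟩
    b + sel (λ y ys → K x y ys + sel (λ z zs → K z y (x ∷ zs)) ys) xs ∎
    where
    open ≡-Reasoning
    a = sel (K x) xs
    b = sel (λ y → K y x) xs
    c = sel (λ y → sel (λ z zs → K y z (x ∷ zs))) xs
    d = sel (λ y → sel (λ z zs → K z y (x ∷ zs))) xs

  perm∑-cong : ∀ n {g g′ : List A → ℕ} xs → length xs ≡ n → (∀ ys → ys ↭ xs → g ys ≡ g′ ys) →
    perm∑ n g xs ≡ perm∑ n g′ xs
  perm∑-cong zero    []       l e = e [] ↭-refl
  perm∑-cong (suc n) xs l e = sel-cong xs λ y ys p →
    perm∑-cong n ys (suc-injective (trans (↭-length p) l)) (λ zs q → e (y ∷ zs) (↭-trans (prep y q) p))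

  perm∑-ext : ∀ n {g g′ : List A → ℕ} xs → (∀ ys → g ys ≡ g′ ys) → perm∑ n g xs ≡ perm∑ n g′ xs
  perm∑-ext zero    xs e = e []
  perm∑-ext (suc n) xs e = sel-cong xs λ y ys _ → perm∑-ext n ys (λ zs → e (y ∷ zs))

  perm∑-+ : ∀ n (g g′ : List A → ℕ) xs → perm∑ n (λ ys → g ys + g′ ys) xs ≡ perm∑ n g xs + perm∑ n g′ xs
  perm∑-+ zero    g g′ xs = refl
  perm∑-+ (suc n) g g′ xs =
    trans (sel-cong xs λ y ys _ → perm∑-+ n (g ∘ (y ∷_)) (g′ ∘ (y ∷_)) ys) (sel-+ _ _ xs)

  perm∑-const : ∀ n c (xs : List A) → length xs ≡ n → perm∑ n (λ _ → c) xs ≡ n ! * c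
  perm∑-const zero    c xs l = sym (+-identityʳ c)
  perm∑-const (suc n) c xs l = begin
    sel (λ y ys → perm∑ n (λ _ → c) ys) xs
      ≡⟨ sel-cong xs (λ y ys p → perm∑-const n c ys (suc-injective (trans (↭-length p) l))) ⟩
    sel (λ _ _ → n ! * c) xs ≡⟨ sel-const _ xs ⟩
    length xs * (n ! * c)    ≡⟨ cong (_* (n ! * c)) l ⟩
    suc n * (n ! * c)        ≡⟨ sym (*-assoc (suc n) (n !) c) ⟩
    suc n ! * c ∎
    where open ≡-Reasoning

  perm∑-mono : ∀ n {g g′ : List A → ℕ} xs → length xs ≡ n → (∀ ys → ys ↭ xs → g ys ≤ g′ ys) →
    perm∑ n g xs ≤ perm∑ n g′ xs
  perm∑-mono n {g} {g′} xs l h = subst (perm∑ n g xs ≤_)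
    -- Monotonicity comes from additivity: on permutations of xs, `g′` is `g` plus the truncated
    -- difference.
    (trans (sym (perm∑-+ n g (λ ys → g′ ys ∸ g ys) xs)) (perm∑-cong n xs l λ ys p → m+[n∸m]≡n (h ys p)))
    (m≤m+n _ _)

  perm∑-zero : ∀ n (xs : List A) → perm∑ n (λ _ → 0) xs ≡ 0
  perm∑-zero n xs = +-cancelˡ-≡ _ _ _ (trans (sym (perm∑-+ n (λ _ → 0) (λ _ → 0) xs)) (sym (+-identityʳ _)))

  perm∑-* : ∀ n c (g : List A → ℕ) xs → perm∑ n (λ ys → c * g ys) xs ≡ c * perm∑ n g xs
  perm∑-* n zero    g xs = perm∑-zero n xs
  perm∑-* n (suc c) g xs = trans (perm∑-+ n g (λ ys → c * g ys) xs) (cong (perm∑ n g xs +_) (perm∑-* n c g xs))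

  perm∑-Σ< : ∀ n k (g : ℕ → List A → ℕ) xs →
    perm∑ n (λ ys → Σ< k (λ i → g i ys)) xs ≡ Σ< k (λ i → perm∑ n (g i) xs)
  perm∑-Σ< n zero    g xs = perm∑-zero n xs
  perm∑-Σ< n (suc k) g xs =
    trans (perm∑-+ n (g 0) _ xs) (cong (perm∑ n (g 0) xs +_) (perm∑-Σ< n k (g ∘ suc) xs))

  perm∑-Σₗ : ∀ n (zs : List B) (g : B → List A → ℕ) xs →
    perm∑ n (λ ys → Σₗ zs (λ z → g z ys)) xs ≡ Σₗ zs (λ z → perm∑ n (g z) xs)
  perm∑-Σₗ n []       g xs = perm∑-zero n xs
  perm∑-Σₗ n (z ∷ zs) g xs =
    trans (perm∑-+ n (g z) _ xs) (cong (perm∑ n (g z) xs +_) (perm∑-Σₗ n zs g xs))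

  perm∑-↭ : ∀ n (g : List A → ℕ) {xs ys} → xs ↭ ys → perm∑ n g xs ≡ perm∑ n g ys
  perm∑-↭ zero    g p = refl
  perm∑-↭ (suc n) g p = sel-↭ _ (λ y q → perm∑-↭ n (g ∘ (y ∷_)) q) p

  swapAt : ℕ → List A → List A
  swapAt zero    (x ∷ y ∷ zs) = y ∷ x ∷ zs
  swapAt (suc p) (x ∷ xs)     = x ∷ swapAt p xs
  -- A position without a right neighbour leaves the list alone, so `p` needs no bound anywhere.
  swapAt _       xs           = xs

  swapAt-↭ : ∀ p (xs : List A) → swapAt p xs ↭ xs
  swapAt-↭ zero    []           = ↭-refl
  swapAt-↭ zero    (x ∷ [])     = ↭-refl
  swapAt-↭ zero    (x ∷ y ∷ zs) = swap y x ↭-refl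
  swapAt-↭ (suc p) []           = ↭-refl
  swapAt-↭ (suc p) (x ∷ xs)     = prep x (swapAt-↭ p xs)

  perm∑-swapAt : ∀ n p (g : List A → ℕ) xs → perm∑ n (g ∘ swapAt p) xs ≡ perm∑ n g xs
  perm∑-swapAt zero          zero    g xs = refl
  perm∑-swapAt zero          (suc p) g xs = refl
  perm∑-swapAt (suc zero)    zero    g xs = refl
  perm∑-swapAt (suc (suc n)) zero    g xs = sel-comm (λ y z zs → perm∑ n (λ ws → g (z ∷ y ∷ ws)) zs) xs
  perm∑-swapAt (suc n)       (suc p) g xs = sel-cong xs λ y ys _ → perm∑-swapAt n p (g ∘ (y ∷_)) ys

  rot : List A → List A
  rot []       = []
  rot (x ∷ xs) = xs ++ x ∷ []

  rot-↭ : ∀ (xs : List A) → rot xs ↭ xs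
  rot-↭ []       = ↭-refl
  rot-↭ (x ∷ xs) = ↭-sym (∷↭∷ʳ x xs)

  -- A rotation transposes the first two entries and then rotates the tail, which now begins with
  -- the old first entry. The transposition is absorbed by `perm∑-swapAt`, the rotation of the tail
  -- by induction.
  perm∑-rot : ∀ n (g : List A → ℕ) xs → perm∑ n (g ∘ rot) xs ≡ perm∑ n g xs
  perm∑-rot zero          g xs = refl
  perm∑-rot (suc zero)    g xs = refl
  perm∑-rot (suc (suc n)) g xs = trans
    (perm∑-swapAt (suc (suc n)) 0 rotTail xs)
    (sel-cong xs λ y ys _ → perm∑-rot (suc n) (g ∘ (y ∷_)) ys)
    where
    rotTail : List _ → ℕ
    rotTail []       = g []
    rotTail (y ∷ ws) = g (y ∷ rot ws)

  -- Words in adjacent transpositions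

  𝟙 : Bool → ℕ
  𝟙 true  = 1
  𝟙 false = 0

  𝟙-not : ∀ b → 𝟙 b + 𝟙 (not b) ≡ 1
  𝟙-not true  = refl
  𝟙-not false = refl

  run : List ℕ → List A → List A
  run []      xs = xs
  run (p ∷ w) xs = run w (swapAt p xs)

  -- The letters are i ∸ 1, ..., 1, 0: the entry at place i travels to the front and the others keep
  -- their order.
  toFront : ℕ → List ℕ
  toFront zero    = []
  toFront (suc i) = map suc (toFront i) ++ 0 ∷ []

  -- The sum of f over words in adjacent transpositions representing each permutation of n positions once.
  word∑ : ℕ → (List ℕ → ℕ) → ℕ
  word∑ zero    f = f []
  word∑ (suc n) f = Σ< (suc n) λ i → word∑ n λ w → f (toFront i ++ map suc w)

  run-++ : ∀ w w′ (xs : List A) → run (w ++ w′) xs ≡ run w′ (run w xs)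
  run-++ []      w′ xs = refl
  run-++ (p ∷ w) w′ xs = run-++ w w′ (swapAt p xs)

  run-map-suc : ∀ w (x : A) xs → run (map suc w) (x ∷ xs) ≡ x ∷ run w xs
  run-map-suc []      x xs = refl
  run-map-suc (p ∷ w) x xs = run-map-suc w x (swapAt p xs)

  uncons : (A → List A → ℕ) → List A → ℕ
  uncons h []       = 0
  uncons h (x ∷ xs) = h x xs

  run-↭ : ∀ w (xs : List A) → run w xs ↭ xs
  run-↭ []      xs = ↭-refl
  run-↭ (p ∷ w) xs = ↭-trans (run-↭ w (swapAt p xs)) (swapAt-↭ p xs)

  sel-toFront : ∀ (h : A → List A → ℕ) xs → sel h xs ≡ Σ< (length xs) (λ i → uncons h (run (toFront i) xs))
  sel-toFront h []       = refl
  sel-toFront h (x ∷ xs) = cong (h x xs +_) (trans (sel-toFront (λ y ys → h y (x ∷ ys)) xs)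
    (Σ<-cong (length xs) λ i i<n → trans
      (uncons-swap (run (toFront i) xs)
        (subst (0 <_) (sym (↭-length (run-↭ (toFront i) xs))) (≤-<-trans z≤n i<n)))
      (cong (uncons h) (sym (trans (run-++ (map suc (toFront i)) (0 ∷ []) (x ∷ xs))
        (cong (swapAt 0) (run-map-suc (toFront i) x xs)))))))
    where
    uncons-swap : ∀ ys → 0 < length ys → uncons (λ y ys → h y (x ∷ ys)) ys ≡ uncons h (swapAt 0 (x ∷ ys))
    uncons-swap (y ∷ ys) _ = refl

  word∑-cong : ∀ n {f f′ : List ℕ → ℕ} → (∀ w → f w ≡ f′ w) → word∑ n f ≡ word∑ n f′
  word∑-cong zero    e = e []
  word∑-cong (suc n) e = Σ<-cong (suc n) λ i _ → word∑-cong n λ w → e (toFront i ++ map suc w)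

  -- The words do not depend on the list on which they act. This allows the sum over a second
  -- ordering to be taken outside the sum over the first.
  perm∑-word∑ : ∀ n (g : List A → ℕ) xs → length xs ≡ n → perm∑ n g xs ≡ word∑ n (λ w → g (run w xs))
  perm∑-word∑ zero    g []       l    = refl
  perm∑-word∑ (suc n) g (x ∷ xs) refl = begin
    sel (λ y ys → perm∑ n (g ∘ (y ∷_)) ys) (x ∷ xs)
      ≡⟨ sel-cong (x ∷ xs) (λ y ys p → perm∑-word∑ n (g ∘ (y ∷_)) ys (suc-injective (↭-length p))) ⟩
    sel h (x ∷ xs)
      ≡⟨ sel-toFront h (x ∷ xs) ⟩
    Σ< (suc n) (λ i → uncons h (run (toFront i) (x ∷ xs)))
      ≡⟨ Σ<-cong (suc n) (λ i _ → trans
          (uncons-word (run (toFront i) (x ∷ xs)) (subst (0 <_) (sym (↭-length (run-↭ (toFront i) (x ∷ xs)))) (s≤s z≤n)))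
          (word∑-cong n λ w → cong g (sym (run-++ (toFront i) (map suc w) (x ∷ xs))))) ⟩
    word∑ (suc n) (λ w → g (run w (x ∷ xs))) ∎
    where
    open ≡-Reasoning
    h = λ y ys → word∑ n λ w → g (y ∷ run w ys)
    uncons-word : ∀ ys → 0 < length ys → uncons h ys ≡ word∑ n (λ w → g (run (map suc w) ys))
    uncons-word (y ∷ ys) _ = word∑-cong n λ w → cong g (sym (run-map-suc w y ys))

  perm∑-word∑-comm : ∀ n k (G : List ℕ → List A → ℕ) xs →
    perm∑ n (λ ys → word∑ k (λ w → G w ys)) xs ≡ word∑ k (λ w → perm∑ n (G w) xs)
  perm∑-word∑-comm n zero    G xs = refl
  perm∑-word∑-comm n (suc k) G xs = trans
    (perm∑-Σ< n (suc k) (λ i ys → word∑ k λ w → G (toFront i ++ map suc w) ys) xs)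
    (Σ<-cong (suc k) λ i _ → perm∑-word∑-comm n k (λ w → G (toFront i ++ map suc w)) xs)

  length-toFront : ∀ i → length (toFront i) ≡ i
  length-toFront zero    = refl
  length-toFront (suc i) = begin
    length (map suc (toFront i) ++ 0 ∷ [])     ≡⟨ length-++ (map suc (toFront i)) ⟩
    length (map suc (toFront i)) + 1           ≡⟨ cong (_+ 1) (trans (length-map suc (toFront i)) (length-toFront i)) ⟩
    i + 1                                      ≡⟨ +-comm i 1 ⟩
    suc i ∎
    where open ≡-Reasoning

  -- Bringing entries to the front one after another takes at most (n ∸ 1) + ... + 1 + 0
  -- transpositions; the estimate is relaxed to n²/2 and doubled to stay in ℕ.
  word∑-bound : ∀ n (f : List ℕ → ℕ) c → (∀ w → 2 * length w ≤ n * n → f w ≤ c) → word∑ n f ≤ n ! * c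
  word∑-bound zero    f c h = ≤-trans (h [] z≤n) (≤-reflexive (sym (+-identityʳ c)))
  word∑-bound (suc n) f c h = begin
    Σ< (suc n) (λ i → word∑ n λ w → f (toFront i ++ map suc w))
      ≤⟨ Σ<-mono (suc n) (λ i i<n → word∑-bound n (λ w → f (toFront i ++ map suc w)) c λ w l → h (toFront i ++ map suc w) (length-bound i w (≤-pred i<n) l)) ⟩
    Σ< (suc n) (λ _ → n ! * c)   ≡⟨ Σ<-const (suc n) (n ! * c) ⟩
    suc n * (n ! * c)            ≡⟨ sym (*-assoc (suc n) (n !) c) ⟩
    suc n ! * c ∎
    where
    open ≤-Reasoning
    square : ∀ n → 2 * n + n * n + 1 ≡ suc n * suc n
    square = solve-∀
    length-bound : ∀ i w → i ≤ n → 2 * length w ≤ n * n → 2 * length (toFront i ++ map suc w) ≤ suc n * suc n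
    length-bound i w i≤n l = begin
      2 * length (toFront i ++ map suc w) ≡⟨ cong (2 *_) (trans (length-++ (toFront i))
                                               (cong₂ _+_ (length-toFront i) (length-map suc w))) ⟩
      2 * (i + length w)                  ≡⟨ *-distribˡ-+ 2 i (length w) ⟩
      2 * i + 2 * length w                ≤⟨ +-mono-≤ (*-monoʳ-≤ 2 i≤n) l ⟩
      2 * n + n * n                       ≤⟨ m≤m+n _ 1 ⟩
      2 * n + n * n + 1                   ≡⟨ square n ⟩
      suc n * suc n ∎

  -- Isoperimetry for adjacent transpositions

  module _ (n : ℕ) (τ : List A) (|τ|≡n : length τ ≡ n) (S : List A → Bool) where

    private
      leave : List A → List A → ℕ
      leave ρ ρ′ = 𝟙 (S ρ) * 𝟙 (not (S ρ′))

      leave-diag : ∀ ρ → leave ρ ρ ≡ 0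
      leave-diag ρ with S ρ
      ... | true  = refl
      ... | false = refl

      leave-triangle : ∀ ρ₁ ρ₂ ρ₃ → leave ρ₁ ρ₃ ≤ leave ρ₁ ρ₂ + leave ρ₂ ρ₃
      leave-triangle ρ₁ ρ₂ ρ₃ with S ρ₁ | S ρ₂ | S ρ₃
      ... | false | _     | _     = z≤n
      ... | true  | true  | c     = ≤-refl
      ... | true  | false | true  = z≤n
      ... | true  | false | false = ≤-refl

    module _ (u : ℕ) (step : ∀ p → perm∑ n (λ ρ → leave ρ (swapAt p ρ)) τ ≤ u) where

      leave-run : ∀ w → perm∑ n (λ ρ → leave ρ (run w ρ)) τ ≤ length w * u
      leave-run []      = ≤-reflexive (trans (perm∑-ext n τ leave-diag) (perm∑-zero n τ))
      leave-run (p ∷ w) = begin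
        perm∑ n (λ ρ → leave ρ (run w (swapAt p ρ))) τ
          ≤⟨ perm∑-mono n τ |τ|≡n (λ ρ _ → leave-triangle ρ (swapAt p ρ) (run w (swapAt p ρ))) ⟩
        perm∑ n (λ ρ → leave ρ (swapAt p ρ) + leave (swapAt p ρ) (run w (swapAt p ρ))) τ
          ≡⟨ perm∑-+ n _ _ τ ⟩
        perm∑ n (λ ρ → leave ρ (swapAt p ρ)) τ + perm∑ n (λ ρ → leave (swapAt p ρ) (run w (swapAt p ρ))) τ
          ≡⟨ cong (perm∑ n (λ ρ → leave ρ (swapAt p ρ)) τ +_) (perm∑-swapAt n p (λ ρ → leave ρ (run w ρ)) τ) ⟩
        perm∑ n (λ ρ → leave ρ (swapAt p ρ)) τ + perm∑ n (λ ρ → leave ρ (run w ρ)) τ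
          ≤⟨ +-mono-≤ (step p) (leave-run w) ⟩
        u + length w * u ∎
        where open ≤-Reasoning

      -- A uniformly random pair (ρ, ρ′) is joined by at most n²/2 adjacent transpositions, and each
      -- of these steps starts at a uniformly random ordering.
      isoperimetry : 2 * (perm∑ n (𝟙 ∘ S) τ * perm∑ n (𝟙 ∘ not ∘ S) τ) ≤ n ! * (n * n * u)
      isoperimetry = begin
        2 * (perm∑ n (𝟙 ∘ S) τ * t)
          ≡⟨ cong (2 *_) (trans (*-comm _ t) (sym (perm∑-* n t (𝟙 ∘ S) τ))) ⟩
        2 * perm∑ n (λ ρ → t * 𝟙 (S ρ)) τ
          -- The number `t` of orderings outside S is recomputed over the permutations of ρ in place
          -- of τ, so that the second ordering becomes `run w ρ`.
          ≡⟨ cong (2 *_) (perm∑-cong n τ |τ|≡n λ ρ p → trans (*-comm t (𝟙 (S ρ)))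
               (trans (cong (𝟙 (S ρ) *_) (perm∑-↭ n (𝟙 ∘ not ∘ S) (↭-sym p)))
               (trans (sym (perm∑-* n (𝟙 (S ρ)) (𝟙 ∘ not ∘ S) ρ))
                      (perm∑-word∑ n (leave ρ) ρ (trans (↭-length p) |τ|≡n))))) ⟩
        2 * perm∑ n (λ ρ → word∑ n (λ w → leave ρ (run w ρ))) τ
          ≡⟨ cong (2 *_) (perm∑-word∑-comm n n (λ w ρ → leave ρ (run w ρ)) τ) ⟩
        2 * word∑ n (λ w → perm∑ n (λ ρ → leave ρ (run w ρ)) τ)
          ≡⟨ word∑-double n _ ⟩
        word∑ n (λ w → 2 * perm∑ n (λ ρ → leave ρ (run w ρ)) τ)
          ≤⟨ word∑-bound n _ (n * n * u) (λ w l → ≤-trans (*-monoʳ-≤ 2 (leave-run w))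
               (≤-trans (≤-reflexive (sym (*-assoc 2 (length w) u))) (*-monoˡ-≤ u l))) ⟩
        n ! * (n * n * u) ∎
        where
        open ≤-Reasoning
        t = perm∑ n (𝟙 ∘ not ∘ S) τ
        Σ<-double : ∀ k (f : ℕ → ℕ) → 2 * Σ< k f ≡ Σ< k (λ i → 2 * f i)
        Σ<-double zero    f = refl
        Σ<-double (suc k) f = trans (*-distribˡ-+ 2 (f 0) _) (cong (2 * f 0 +_) (Σ<-double k (f ∘ suc)))
        word∑-double : ∀ k (f : List ℕ → ℕ) → 2 * word∑ k f ≡ word∑ k (λ w → 2 * f w)
        word∑-double zero    f = refl
        word∑-double (suc k) f = trans (Σ<-double (suc k) (λ i → word∑ k λ w → f (toFront i ++ map suc w)))
          (Σ<-cong (suc k) λ i _ → word∑-double k λ w → f (toFront i ++ map suc w))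

  -- Gapless chains of arcs on a cycle

  first-below : ∀ (b : ℕ → Bool) l →
    (∃ λ y → y < l × b y ≡ false × (∀ z → z < y → b z ≡ true)) ⊎ (∀ z → z < l → b z ≡ true)
  first-below b zero = inj₂ λ _ ()
  first-below b (suc l) with first-below b l
  ... | inj₁ (y , y<l , by , min) = inj₁ (y , m≤n⇒m≤1+n y<l , by , min)
  ... | inj₂ all with b l in bl
  ...   | false = inj₁ (l , ≤-refl , bl , all)
  ...   | true  = inj₂ λ z z<1+l → case-≤ z (m≤n⇒m<n∨m≡n (≤-pred z<1+l))
    where
    case-≤ : ∀ z → z < l ⊎ z ≡ l → b z ≡ true
    case-≤ z (inj₁ z<l)  = all z z<l
    case-≤ z (inj₂ refl) = bl

  -- Starting points x ≤ … ≤ y, each satisfying b, of l consecutive arcs of length m which leave no gaps.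
  data Chain (b : ℕ → Bool) (m : ℕ) : ℕ → ℕ → ℕ → Set where
    one  : ∀ {x} → b x ≡ true → Chain b m 1 x x
    step : ∀ {l x y z} → Chain b m l x y → y ≤ z → z ≤ y + m → b z ≡ true → Chain b m (suc l) x z

  module _ {b : ℕ → Bool} {m : ℕ} where

    chain-end : ∀ {l x y} → Chain b m l x y → b y ≡ true
    chain-end (one bx)        = bx
    chain-end (step _ _ _ bz) = bz

    -- Intersection is assumed for exactly k members, with repetition allowed, so a shorter chain
    -- repeats its last arc.
    chain-pad : ∀ {l x y} d → Chain b m l x y → Chain b m (d + l) x y
    chain-pad zero    c = c
    chain-pad (suc d) c = step (chain-pad d c) ≤-refl (m≤m+n _ m) (chain-end c)

  below : ℕ → ℕ → ℕ
  below c i = 𝟙 (does (i <? c))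

  below≤1 : ∀ c i → below c i ≤ 1
  below≤1 c i with does (i <? c)
  ... | true  = ≤-refl
  ... | false = z≤n

  below-yes : ∀ {c i} → i < c → below c i ≡ 1
  below-yes {c} {i} i<c = cong 𝟙 (dec-true (i <? c) i<c)

  below-no : ∀ {c i} → ¬ i < c → below c i ≡ 0
  below-no {c} {i} i≮c = cong 𝟙 (dec-false (i <? c) i≮c)

  below-antitone : ∀ c i → below c (suc i) ≤ below c i
  below-antitone c i with i <? c
  ... | yes i<c = ≤-trans (below≤1 c (suc i)) (≤-reflexive (sym (below-yes i<c)))
  ... | no  i≮c = ≤-trans (≤-reflexive (below-no (λ 1+i<c → i≮c (<-trans ≤-refl 1+i<c)))) z≤n

  -- b x says that the complement [x, x + m) of the arc [x + m, x + n) of the n-cycle comes from a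
  -- member of the family; by k-wise intersection no k such complements cover the cycle.
  module Cycle (n m k : ℕ) (0<m : 0 < m) (m≤n : m ≤ n) (n<km : n < k * m)
               (b : ℕ → Bool) (b0 : b 0 ≡ true) (bn : b n ≡ true)
               (uncovered : ∀ {x y} → Chain b m k x y → y + m < x + n) where

    private
      instance
        m≢0 : NonZero m
        m≢0 = >-nonZero 0<m

      0<k : 0 < k
      0<k = helper k n<km
        where
        helper : ∀ k → n < k * m → 0 < k
        helper (suc k) _ = s≤s z≤n

    module _ (f : ℕ → ℕ) (f0≤m : f 0 ≤ m) (f↑ : ∀ i → f i ≤ f (suc i)) (f-step : ∀ i → f (suc i) ≤ f i + m) where

      chain-from : ∀ q → (∀ i → i ≤ q → b (f i) ≡ true) → Chain b m (suc q) (f 0) (f q)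
      chain-from zero    h = one (h 0 z≤n)
      chain-from (suc q) h = step (chain-from q λ i i≤q → h i (m≤n⇒m≤1+n i≤q)) (f↑ q) (f-step q) (h (suc q) ≤-refl)

      chain-from-0 : ∀ q → (∀ i → i ≤ q → b (f i) ≡ true) → Chain b m (suc (suc q)) 0 (f q)
      chain-from-0 zero    h = step (one b0) z≤n f0≤m (h 0 z≤n)
      chain-from-0 (suc q) h = step (chain-from-0 q λ i i≤q → h i (m≤n⇒m≤1+n i≤q)) (f↑ q) (f-step q) (h (suc q) ≤-refl)

      -- A path with fewer than k terms leaves room for the arc at 0 in front, and the chain then
      -- covers [0, n). Otherwise its first k terms already cover a full turn from `f 0`.
      no-path : ∀ q → (∀ i → i ≤ q → b (f i) ≡ true) → n ≤ f q + m → f 0 + n ≤ f (k ∸ 1) + m → ⊥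
      no-path q h end long with suc (suc q) ≤? k
      ... | yes 2+q≤k = <⇒≱ (uncovered
              (subst (λ l → Chain b m l 0 (f q)) (m∸n+n≡m 2+q≤k) (chain-pad (k ∸ suc (suc q)) (chain-from-0 q h)))) end
      ... | no  2+q≰k = <⇒≱ (uncovered
              (subst (λ l → Chain b m l (f 0) (f (k ∸ 1))) (m+[n∸m]≡n 0<k)
                (chain-from (k ∸ 1) λ i i≤k-1 → h i (≤-trans i≤k-1 k-1≤q)))) long
        where
        k-1≤q : k ∸ 1 ≤ q
        k-1≤q = ∸-monoˡ-≤ 1 (≤-pred (≰⇒> 2+q≰k))

    -- Follows the residue class of j + 1 modulo m for c terms and then that of j. The switch loses
    -- one position of coverage, which n < k * m affords.
    residue-path : ℕ → ℕ → ℕ → ℕ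
    residue-path c j i = i * m + j + below c i

    -- If b held along the whole path, `no-path` would apply. The bound concerns i m + j and not the
    -- value of the path, which may equal n after the shift by one.
    residue-path-hits : ∀ c {j} → j < m → ∃ λ i → i * m + j < n × b (residue-path c j i) ≡ false
    residue-path-hits c {j} j<m with first-below (b ∘ f) (suc q)
      where
      f = residue-path c j
      -- The largest i with i m + j < n.
      q = (n ∸ suc j) / m
    ... | inj₁ (i , i<1+q , bf , _) = i , ≤-<-trans (+-monoˡ-≤ j (*-monoˡ-≤ m (≤-pred i<1+q))) qm+j<n , bf
      where
      q = (n ∸ suc j) / m
      qm+j<n : q * m + j < n
      qm+j<n = begin-strict
        q * m + j                               ≤⟨ +-monoˡ-≤ j (m≤n+m (q * m) ((n ∸ suc j) % m)) ⟩
        (n ∸ suc j) % m + q * m + j             ≡⟨ cong (_+ j) (sym (m≡m%n+[m/n]*n (n ∸ suc j) m)) ⟩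
        n ∸ suc j + j                           <⟨ +-monoʳ-< (n ∸ suc j) (n<1+n j) ⟩
        n ∸ suc j + suc j                       ≡⟨ m∸n+n≡m (<-≤-trans j<m m≤n) ⟩
        n ∎
        where open ≤-Reasoning
    ... | inj₂ all = ⊥-elim (no-path f f0≤m f↑ f-step q (λ i i≤q → all i (s≤s i≤q)) end long)
      where
      f = residue-path c j
      q = (n ∸ suc j) / m
      open ≤-Reasoning
      f0≤m : f 0 ≤ m
      f0≤m = ≤-trans (+-monoʳ-≤ j (below≤1 c 0)) (≤-trans (≤-reflexive (+-comm j 1)) j<m)
      rearrange : ∀ i m j → (i * m + j) + m ≡ suc i * m + j
      rearrange = solve-∀
      f↑ : ∀ i → f i ≤ f (suc i)
      f↑ i = begin
        i * m + j + below c i  ≤⟨ +-monoʳ-≤ (i * m + j) (≤-trans (below≤1 c i) 0<m) ⟩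
        i * m + j + m          ≡⟨ rearrange i m j ⟩
        suc i * m + j          ≤⟨ m≤m+n _ _ ⟩
        f (suc i) ∎
      f-step : ∀ i → f (suc i) ≤ f i + m
      f-step i = begin
        suc i * m + j + below c (suc i)  ≤⟨ +-monoʳ-≤ (suc i * m + j) (below-antitone c i) ⟩
        suc i * m + j + below c i        ≡⟨ cong (_+ below c i) (sym (rearrange i m j)) ⟩
        i * m + j + m + below c i        ≡⟨ +-assoc (i * m + j) m _ ⟩
        i * m + j + (m + below c i)      ≡⟨ cong (i * m + j +_) (+-comm m _) ⟩
        i * m + j + (below c i + m)      ≡⟨ sym (+-assoc (i * m + j) (below c i) m) ⟩
        f i + m ∎
      end : n ≤ f q + m
      end = begin
        n                                      ≡⟨ sym (m∸n+n≡m (<-≤-trans j<m m≤n)) ⟩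
        n ∸ suc j + suc j                      ≡⟨ cong (_+ suc j) (m≡m%n+[m/n]*n (n ∸ suc j) m) ⟩
        (n ∸ suc j) % m + q * m + suc j        ≡⟨ +-suc _ j ⟩
        suc ((n ∸ suc j) % m) + q * m + j      ≤⟨ +-monoˡ-≤ j (+-monoˡ-≤ (q * m) (m%n<n (n ∸ suc j) m)) ⟩
        m + q * m + j                          ≡⟨ sym (rearrange q m j) ⟩
        q * m + j + m                          ≤⟨ +-monoˡ-≤ m (m≤m+n _ (below c q)) ⟩
        f q + m ∎
      long : f 0 + n ≤ f (k ∸ 1) + m
      long = begin
        j + below c 0 + n          ≤⟨ +-monoˡ-≤ n (+-monoʳ-≤ j (below≤1 c 0)) ⟩
        j + 1 + n                  ≡⟨ +-assoc j 1 n ⟩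
        j + suc n                  ≤⟨ +-monoʳ-≤ j n<km ⟩
        j + k * m                  ≡⟨ cong (λ l → j + l * m) (sym (m+[n∸m]≡n 0<k)) ⟩
        j + suc (k ∸ 1) * m        ≡⟨ +-comm j _ ⟩
        suc (k ∸ 1) * m + j        ≡⟨ sym (rearrange (k ∸ 1) m j) ⟩
        (k ∸ 1) * m + j + m        ≤⟨ +-monoˡ-≤ m (m≤m+n _ (below c (k ∸ 1))) ⟩
        f (k ∸ 1) + m ∎

    -- The residue classes fill a k × m grid of positions, which extends beyond n; positions from n
    -- on must not count.
    missing : ℕ → ℕ
    missing x = 𝟙 (does (x <? n) ∧ not (b x))

    missing-yes : ∀ {x} → x < n → b x ≡ false → missing x ≡ 1
    missing-yes {x} x<n bx = cong₂ (λ s t → 𝟙 (s ∧ not t)) (dec-true (x <? n) x<n) bx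

    Σ-missing : Σ< (k * m) missing ≡ Σ< n (𝟙 ∘ not ∘ b)
    Σ-missing = begin
      Σ< (k * m) missing                                        ≡⟨ cong (λ l → Σ< l missing) (sym (m+[n∸m]≡n (<⇒≤ n<km))) ⟩
      Σ< (n + (k * m ∸ n)) missing                              ≡⟨ Σ<-split n (k * m ∸ n) missing ⟩
      Σ< n missing + Σ< (k * m ∸ n) (λ i → missing (n + i))     ≡⟨ cong₂ _+_
          (Σ<-cong n λ x x<n → cong (λ s → 𝟙 (s ∧ not (b x))) (dec-true (x <? n) x<n))
          (trans (Σ<-cong (k * m ∸ n) λ i _ → cong (λ s → 𝟙 (s ∧ not (b (n + i)))) (dec-false (n + i <? n) (m+n≮m n i)))
                 (trans (Σ<-const (k * m ∸ n) 0) (*-zeroʳ (k * m ∸ n)))) ⟩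
      Σ< n (𝟙 ∘ not ∘ b) + 0                                    ≡⟨ +-identityʳ _ ⟩
      Σ< n (𝟙 ∘ not ∘ b) ∎
      where open ≡-Reasoning

    residue-sum : ℕ → ℕ
    residue-sum j = Σ< k λ i → missing (i * m + j)

    Σ-residue-sum : Σ< m residue-sum ≡ Σ< n (𝟙 ∘ not ∘ b)
    Σ-residue-sum = trans (Σ<-comm m k (λ j i → missing (i * m + j)))
      (trans (sym (Σ<-block k m missing)) Σ-missing)

    row<k : ∀ {i j} → i * m + j < n → i < k
    row<k {i} {j} lt = *-cancelʳ-< m i k (≤-<-trans (m≤m+n (i * m) j) (<-trans lt n<km))

    1≤residue-sum : ∀ j → j < m → 1 ≤ residue-sum j
    1≤residue-sum j j<m with residue-path-hits 0 j<m
    ... | i , lt , bi = subst (_≤ residue-sum j)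
      (missing-yes lt (trans (cong b (sym (+-identityʳ (i * m + j)))) bi))
      (Σ<-term k (λ i → missing (i * m + j)) (row<k {i} lt))

    m≤missing : m ≤ Σ< n (𝟙 ∘ not ∘ b)
    m≤missing = begin
      m                       ≡⟨ sym (*-identityʳ m) ⟩
      m * 1                   ≡⟨ sym (Σ<-const m 1) ⟩
      Σ< m (λ _ → 1)          ≤⟨ Σ<-mono m 1≤residue-sum ⟩
      Σ< m residue-sum        ≡⟨ Σ-residue-sum ⟩
      Σ< n (𝟙 ∘ not ∘ b) ∎
      where open ≤-Reasoning

    module _ (missing≤m : Σ< n (𝟙 ∘ not ∘ b) ≤ m) where

      residue-sum≤1 : ∀ {j} → j < m → residue-sum j ≤ 1
      residue-sum≤1 = Σ<-tight m {λ _ → 1} 1≤residue-sum (begin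
        Σ< m residue-sum        ≡⟨ Σ-residue-sum ⟩
        Σ< n (𝟙 ∘ not ∘ b)      ≤⟨ missing≤m ⟩
        m                       ≡⟨ sym (*-identityʳ m) ⟩
        m * 1                   ≡⟨ sym (Σ<-const m 1) ⟩
        Σ< m (λ _ → 1) ∎)
        where open ≤-Reasoning

      missing-unique : ∀ {i i′ j} → j < m → i * m + j < n → i′ * m + j < n →
        b (i * m + j) ≡ false → b (i′ * m + j) ≡ false → ¬ i < i′
      missing-unique {i} {i′} {j} j<m lt lt′ bi bi′ i<i′ = <⇒≱ {1} {2} ≤-refl (begin
        2                                             ≡⟨ sym (cong₂ _+_ (missing-yes lt bi) (missing-yes lt′ bi′)) ⟩
        missing (i * m + j) + missing (i′ * m + j)    ≤⟨ Σ<-two-terms k (λ i → missing (i * m + j)) i<i′ (row<k {i′} lt′) ⟩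
        residue-sum j                                 ≤⟨ residue-sum≤1 j<m ⟩
        1 ∎)
        where open ≤-Reasoning

      module _ (y : ℕ) (min : ∀ z → z < y → b z ≡ true) where

        -- Let x = y + i lie in row c and class j. The path that runs through class j + 1 up to row
        -- c and through class j afterwards meets a missing position. It cannot do so after row c,
        -- since x is the only missing position of class j, nor before row c, since the values there
        -- are at most x + 1 ∸ m and hence below y. So it does in row c, at x + 1.
        next-missing : ∀ i → suc i < m → y + i < n → b (y + i) ≡ false →
          suc (y + i) < n × b (suc (y + i)) ≡ false
        next-missing i 1+i<m x<n bx = found (residue-path-hits (suc c) j<m)
          where
          x = y + i
          j = x % m
          c = x / m
          j<m : j < m
          j<m = m%n<n x m
          cm+j≡x : c * m + j ≡ x
          cm+j≡x = trans (+-comm (c * m) j) (sym (m≡m%n+[m/n]*n x m))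
          found : (∃ λ i′ → i′ * m + j < n × b (residue-path (suc c) j i′) ≡ false) →
            suc x < n × b (suc x) ≡ false
          found (i′ , lt , bz) with <-cmp i′ c
          ... | tri> i′≯c _ c<i′ = ⊥-elim (missing-unique {c} {i′} j<m (subst (_< n) (sym cm+j≡x) x<n) lt
                  (trans (cong b cm+j≡x) bx)
                  (trans (cong b (sym (trans (cong (i′ * m + j +_) (below-no {suc c} {i′} (λ { (s≤s le) → <⇒≱ c<i′ le })))
                                             (+-identityʳ _)))) bz)
                  c<i′)
          -- The path may have reached n, but b holds there.
          ... | tri≈ _ refl _ = ≤∧≢⇒< x<n (λ 1+x≡n → contradiction (trans (sym (trans (cong b 1+x≡n) bn)) b1+x) λ ()) , b1+x
            where
            b1+x : b (suc x) ≡ false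
            b1+x = trans (cong b (sym (trans (cong (i′ * m + j +_) (below-yes {suc c} {i′} ≤-refl))
                     (trans (+-comm _ 1) (cong suc cm+j≡x))))) bz
          ... | tri< i′<c _ _ = contradiction (trans (sym (min _ z<y)) bz) λ ()
            where
            z<y : residue-path (suc c) j i′ < y
            z<y = +-cancelʳ-< m _ _ (begin-strict
              i′ * m + j + below (suc c) i′ + m   ≤⟨ +-monoˡ-≤ m (+-monoʳ-≤ (i′ * m + j) (below≤1 (suc c) i′)) ⟩
              i′ * m + j + 1 + m                  ≡⟨ rearrange i′ m j ⟩
              suc (suc i′ * m + j)                ≤⟨ s≤s (+-monoˡ-≤ j (*-monoˡ-≤ m i′<c)) ⟩
              suc (c * m + j)                     ≡⟨ cong suc cm+j≡x ⟩
              suc (y + i)                         ≡⟨ sym (+-suc y i) ⟩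
              y + suc i                           <⟨ +-monoʳ-< y 1+i<m ⟩
              y + m ∎)
              where
              open ≤-Reasoning
              rearrange : ∀ i m j → i * m + j + 1 + m ≡ suc (suc i * m + j)
              rearrange = solve-∀

        missing-window : y < n → b y ≡ false → ∀ i → i < m → y + i < n × b (y + i) ≡ false
        missing-window y<n by zero    _     = subst (_< n) (sym (+-identityʳ y)) y<n , trans (cong b (+-identityʳ y)) by
        missing-window y<n by (suc i) 1+i<m with missing-window y<n by i (<-trans (n<1+n i) 1+i<m)
        ... | lt , bi = subst (λ x → x < n × b x ≡ false) (sym (+-suc y i)) (next-missing i 1+i<m lt bi)

      ∃missing-window : ∃ λ y → ∀ i → i < m → y + i < n × b (y + i) ≡ false
      ∃missing-window with first-below b n
      ... | inj₁ (y , y<n , by , min) = y , missing-window y min y<n by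
      ... | inj₂ all with residue-path-hits 0 0<m
      ...   | i , lt , bi = contradiction (trans (sym (all _ lt)) (trans (cong b (sym (+-identityʳ _))) bi)) λ ()

  -- Cyclic orderings and their arcs

  -- A relation in place of a lookup function: positions carry no bounds, and rotations and swaps
  -- are followed by matching.
  data At {A : Set} : List A → ℕ → A → Set where
    here  : ∀ {x xs} → At (x ∷ xs) 0 x
    there : ∀ {x xs i v} → At xs i v → At (x ∷ xs) (suc i) v

  at-< : ∀ {xs : List A} {i v} → At xs i v → i < length xs
  at-< here      = s≤s z≤n
  at-< (there p) = s≤s (at-< p)

  at-∃ : ∀ (xs : List A) {i} → i < length xs → ∃ (At xs i)
  at-∃ (x ∷ xs) {zero}  _         = x , here
  at-∃ (x ∷ xs) {suc i} (s≤s i<n) with at-∃ xs i<n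
  ... | v , p = v , there p

  at-∈ : ∀ {xs : List A} {i v} → At xs i v → v ∈ₗ xs
  at-∈ here      = here refl
  at-∈ (there p) = there (at-∈ p)

  ∈-at : ∀ {xs : List A} {v} → v ∈ₗ xs → ∃ λ i → At xs i v
  ∈-at (here refl) = 0 , here
  ∈-at (there p) with ∈-at p
  ... | i , q = suc i , there q

  at-unique : ∀ {xs : List A} {i j v} → Unique xs → At xs i v → At xs j v → i ≡ j
  at-unique u        here      here      = refl
  at-unique (x∉ ∷ u) here      (there q) = contradiction refl (All.lookup x∉ (at-∈ q))
  at-unique (x∉ ∷ u) (there p) here      = contradiction refl (All.lookup x∉ (at-∈ p))
  at-unique (x∉ ∷ u) (there p) (there q) = cong suc (at-unique u p q)

  at-drop : ∀ m {xs : List A} {i v} → At xs i v → m ≤ i → v ∈ₗ drop m xs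
  at-drop zero    p         _         = at-∈ p
  at-drop (suc m) (there p) (s≤s m≤i) = at-drop m p m≤i

  drop-at : ∀ m {xs : List A} {v} → v ∈ₗ drop m xs → ∃ λ i → m ≤ i × At xs i v
  drop-at zero    p with ∈-at p
  ... | i , q = i , z≤n , q
  drop-at (suc m) {x ∷ xs} p with drop-at m p
  ... | i , m≤i , q = suc i , s≤s m≤i , there q

  at-++ˡ : ∀ {xs : List A} ys {i v} → At xs i v → At (xs ++ ys) i v
  at-++ˡ ys here      = here
  at-++ˡ ys (there p) = there (at-++ˡ ys p)

  at-∷ʳ : ∀ (xs : List A) {v} → At (xs ++ v ∷ []) (length xs) v
  at-∷ʳ []       = here
  at-∷ʳ (x ∷ xs) = there (at-∷ʳ xs)

  -- The last alternative does not exclude i ≡ p, because a swap at the end of the list does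
  -- nothing.
  at-swapAt : ∀ p {xs : List A} {i v} → At (swapAt p xs) i v →
    (i ≡ p × At xs (suc p) v) ⊎ (i ≡ suc p × At xs p v) ⊎ At xs i v
  at-swapAt zero    {x ∷ []}     q                 = inj₂ (inj₂ q)
  at-swapAt zero    {x ∷ y ∷ zs} here              = inj₁ (refl , there here)
  at-swapAt zero    {x ∷ y ∷ zs} (there here)      = inj₂ (inj₁ (refl , here))
  at-swapAt zero    {x ∷ y ∷ zs} (there (there q)) = inj₂ (inj₂ (there (there q)))
  at-swapAt (suc p) {x ∷ xs}     here              = inj₂ (inj₂ here)
  at-swapAt (suc p) {x ∷ xs}     (there q) with at-swapAt p q
  ... | inj₁ (refl , q′)        = inj₁ (refl , there q′)
  ... | inj₂ (inj₁ (refl , q′)) = inj₂ (inj₁ (refl , there q′))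
  ... | inj₂ (inj₂ q′)          = inj₂ (inj₂ (there q′))

  rots : ℕ → List A → List A
  rots zero    xs = xs
  rots (suc i) xs = rots i (rot xs)

  rots-+ : ∀ i j (xs : List A) → rots (i + j) xs ≡ rots j (rots i xs)
  rots-+ zero    j xs = refl
  rots-+ (suc i) j xs = rots-+ i j (rot xs)

  rots-↭ : ∀ i (xs : List A) → rots i xs ↭ xs
  rots-↭ zero    xs = ↭-refl
  rots-↭ (suc i) xs = ↭-trans (rots-↭ i (rot xs)) (rot-↭ xs)

  rots-++ : ∀ (xs ys : List A) → rots (length xs) (xs ++ ys) ≡ ys ++ xs
  rots-++ []       ys = sym (++-identityʳ ys)
  rots-++ (x ∷ xs) ys = begin
    rots (length xs) ((xs ++ ys) ++ x ∷ [])  ≡⟨ cong (rots (length xs)) (++-assoc xs ys (x ∷ [])) ⟩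
    rots (length xs) (xs ++ ys ++ x ∷ [])    ≡⟨ rots-++ xs (ys ++ x ∷ []) ⟩
    (ys ++ x ∷ []) ++ xs                     ≡⟨ ++-assoc ys (x ∷ []) xs ⟩
    ys ++ x ∷ xs ∎
    where open ≡-Reasoning

  rots-length : ∀ (xs : List A) → rots (length xs) xs ≡ xs
  rots-length xs = trans (cong (rots (length xs)) (sym (++-identityʳ xs))) (rots-++ xs [])

  at-rot : ∀ {xs : List A} {i v} → At xs (suc i) v → At (rot xs) i v
  at-rot (there {x} p) = at-++ˡ (x ∷ []) p

  at-rots : ∀ d {i} {xs : List A} {v} → At xs (d + i) v → At (rots d xs) i v
  at-rots zero    p = p
  at-rots (suc d) p = at-rots d (at-rot p)

  -- After i rotations the entry is in front, one more makes it the last, and the remaining d bring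
  -- it forward by d places.
  at-rots-wrap : ∀ i d {xs : List A} {v} → suc i + d ≤ length xs → At xs i v →
    At (rots (suc i + d) xs) (length xs ∸ suc d) v
  at-rots-wrap zero    d {x ∷ xs} (s≤s le) here =
    at-rots d (subst (λ j → At (rot (x ∷ xs)) j x) (sym (m+[n∸m]≡n le)) (at-∷ʳ xs))
  at-rots-wrap (suc i) d {x ∷ xs} {v} le p =
    subst (λ l → At (rots (suc i + d) (rot (x ∷ xs))) (l ∸ suc d) v) len
      (at-rots-wrap i d (≤-trans (≤-pred (m≤n⇒m≤1+n le)) (≤-reflexive (sym len))) (at-rot p))
    where
    len : length (rot (x ∷ xs)) ≡ length (x ∷ xs)
    len = ↭-length (rot-↭ (x ∷ xs))

  setOf : ∀ {n} → List (Fin n) → Subset n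
  setOf []       = ∅
  setOf (x ∷ xs) = ⁅ x ⁆ ∪ setOf xs

  ∈-setOf⁺ : ∀ {n} {xs : List (Fin n)} {v} → v ∈ₗ xs → v ∈ₛ setOf xs
  ∈-setOf⁺ (here {x} refl) = x∈p∪q⁺ (inj₁ (x∈⁅x⁆ x))
  ∈-setOf⁺ (there p)       = x∈p∪q⁺ (inj₂ (∈-setOf⁺ p))

  ∈-setOf⁻ : ∀ {n} (xs : List (Fin n)) {v} → v ∈ₛ setOf xs → v ∈ₗ xs
  ∈-setOf⁻ []       p = contradiction p ∉⊥
  ∈-setOf⁻ (x ∷ xs) p with x∈p∪q⁻ ⁅ x ⁆ (setOf xs) p
  ... | inj₁ q = here (x∈⁅y⁆⇒x≡y x q)
  ... | inj₂ q = there (∈-setOf⁻ xs q)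

  _∈𝓕?_ : ∀ {n} (B : Subset n) (𝓕 : List (Subset n)) → Dec (B ∈ₗ 𝓕)
  _∈𝓕?_ {n} = DecMembership._∈?_ (≡-dec {n = n} Bool._≟_)

  does-true : ∀ {P : Set} (d : Dec P) → does d ≡ true → P
  does-true (yes p) _ = p

  𝟙-mono : ∀ {P Q : Set} (p : Dec P) (q : Dec Q) → (P → Q) → 𝟙 (does p) ≤ 𝟙 (does q)
  𝟙-mono (yes p) q f = ≤-reflexive (sym (cong 𝟙 (dec-true q (f p))))
  𝟙-mono (no _)  q f = z≤n

  𝟙≤1 : ∀ b → 𝟙 b ≤ 1
  𝟙≤1 true  = ≤-refl
  𝟙≤1 false = z≤n

  𝟙-pos : ∀ b → 1 ≤ 𝟙 b → b ≡ true
  𝟙-pos true _ = refl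

  Ordering : ∀ {n} → List (Fin n) → Set
  Ordering {n} σ = σ ↭ allFin n

  module _ {n : ℕ} {σ : List (Fin n)} (ord : Ordering σ) where

    ordering-length : length σ ≡ n
    ordering-length = trans (↭-length ord) (length-tabulate (λ i → i))

    ordering-unique : Unique σ
    ordering-unique = SetoidPermutation.Unique-resp-↭ (setoid (Fin n)) (↭⇒↭ₛ (↭-sym ord)) (allFin⁺ n)

    ordering-at : ∀ v → ∃ λ i → At σ i v
    ordering-at v = ∈-at (∈-resp-↭ (↭-sym ord) (∈-allFin v))

  rots-ordering : ∀ {n} x {σ : List (Fin n)} → Ordering σ → Ordering (rots x σ)
  rots-ordering x {σ} ord = ↭-trans (rots-↭ x σ) ord

  -- Arcs have length r = n ∸ m and are indexed by the position where their complement begins.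
  arc : ∀ {n} → ℕ → ℕ → List (Fin n) → Subset n
  arc m x σ = setOf (drop m (rots x σ))

  hits : ∀ {n} → ℕ → List (Subset n) → List (Fin n) → ℕ
  hits {n} m 𝓖 σ = Σ< n λ x → 𝟙 (does (arc m x σ ∈𝓕? 𝓖))

  arc-period : ∀ {n} m {σ : List (Fin n)} → Ordering σ → arc m n σ ≡ arc m 0 σ
  arc-period m {σ} ord = cong (setOf ∘ drop m) (trans (cong (λ l → rots l σ) (sym (ordering-length ord))) (rots-length σ))

  module _ {n : ℕ} (m : ℕ) (𝓖 : List (Subset n)) where

    hits-rot : ∀ {σ : List (Fin n)} → Ordering σ → hits m 𝓖 (rot σ) ≡ hits m 𝓖 σ
    hits-rot {σ} ord = Σ<-shift n (λ x → 𝟙 (does (arc m x σ ∈𝓕? 𝓖)))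
      (cong (λ B → 𝟙 (does (B ∈𝓕? 𝓖))) (arc-period m ord))

    hits-rots : ∀ x {σ : List (Fin n)} → Ordering σ → hits m 𝓖 (rots x σ) ≡ hits m 𝓖 σ
    hits-rots zero    ord = refl
    hits-rots (suc x) {σ} ord = trans (hits-rots x (↭-trans (rot-↭ σ) ord)) (hits-rot ord)

  module _ {n m r : ℕ} (m+r≡n : m + r ≡ n) {σ : List (Fin n)} (ord : Ordering σ) where

    private
      len : ∀ x → length (rots x σ) ≡ n
      len x = trans (↭-length (rots-↭ x σ)) (ordering-length ord)

      uniq : ∀ x → Unique (rots x σ)
      uniq x = ordering-unique (rots-ordering x ord)

      at-forward : ∀ {x e v} → x ≤ e → At σ e v → At (rots x σ) (e ∸ x) v
      at-forward {x} {e} {v} x≤e p = at-rots x (subst (λ j → At σ j v) (sym (m+[n∸m]≡n x≤e)) p)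

      at-wrap : ∀ {x e v} → e < x → x ≤ n → At σ e v → At (rots x σ) (n ∸ suc (x ∸ suc e)) v
      at-wrap {x} {e} {v} e<x x≤n p = subst (λ y → At (rots y σ) (n ∸ suc d) v) e+d≡x
        (subst (λ l → At (rots (suc e + d) σ) (l ∸ suc d) v) (len 0)
          (at-rots-wrap e d (≤-trans (≤-reflexive e+d≡x) (≤-trans x≤n (≤-reflexive (sym (len 0))))) p))
        where
        d = x ∸ suc e
        e+d≡x : suc e + d ≡ x
        e+d≡x = m+[n∸m]≡n e<x

      arc-at⁻ : ∀ {x i v} → At (rots x σ) i v → v ∈ₛ arc m x σ → m ≤ i
      arc-at⁻ {x} p v∈ with drop-at m (∈-setOf⁻ (drop m (rots x σ)) v∈)
      ... | j , m≤j , q = subst (m ≤_) (at-unique (uniq x) q p) m≤j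

      arc-at⁺ : ∀ {x i v} → At (rots x σ) i v → m ≤ i → v ∈ₛ arc m x σ
      arc-at⁺ p m≤i = ∈-setOf⁺ (at-drop m p m≤i)

    -- The complement of the arc occupies m cyclic places from x on. An entry at or after x must lie
    -- beyond these; an entry before x is reached after wrapping around and belongs to the arc when
    -- it is at most r places behind x.
    arc-forward⁻ : ∀ {x e v} → At σ e v → x ≤ e → v ∈ₛ arc m x σ → x + m ≤ e
    arc-forward⁻ {x} p x≤e v∈ = ≤-trans (+-monoʳ-≤ x (arc-at⁻ {x} (at-forward x≤e p) v∈)) (≤-reflexive (m+[n∸m]≡n x≤e))

    arc-forward⁺ : ∀ {x e v} → At σ e v → x + m ≤ e → v ∈ₛ arc m x σ
    arc-forward⁺ {x} p le = arc-at⁺ {x} (at-forward (≤-trans (m≤m+n x m) le) p)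
      (≤-trans (≤-reflexive (sym (m+n∸m≡n x m))) (∸-monoˡ-≤ x le))

    arc-wrap⁻ : ∀ {x e v} → At σ e v → e < x → x ≤ n → v ∈ₛ arc m x σ → x ≤ e + r
    arc-wrap⁻ {x} {e} p e<x x≤n v∈ = begin
      x                        ≡⟨ sym (m+[n∸m]≡n e<x) ⟩
      suc e + (x ∸ suc e)      ≡⟨ sym (+-suc e _) ⟩
      e + suc (x ∸ suc e)      ≤⟨ +-monoʳ-≤ e d≤r ⟩
      e + r ∎
      where
      open ≤-Reasoning
      d = suc (x ∸ suc e)
      d≤n : d ≤ n
      d≤n = ≤-trans (≤-trans (m≤n+m d e) (≤-reflexive (trans (+-suc e _) (m+[n∸m]≡n e<x)))) x≤n
      d≤r : d ≤ r
      d≤r = +-cancelˡ-≤ m d r (begin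
        m + d        ≤⟨ +-monoˡ-≤ d (arc-at⁻ {x} (at-wrap e<x x≤n p) v∈) ⟩
        n ∸ d + d    ≡⟨ m∸n+n≡m d≤n ⟩
        n            ≡⟨ sym m+r≡n ⟩
        m + r ∎)

    arc-wrap⁺ : ∀ {x e v} → At σ e v → e < x → x ≤ n → x ≤ e + r → v ∈ₛ arc m x σ
    arc-wrap⁺ {x} {e} p e<x x≤n le = arc-at⁺ {x} (at-wrap e<x x≤n p)
      (≤-trans (≤-reflexive (sym (trans (cong (_∸ r) (sym m+r≡n)) (m+n∸n≡m m r)))) (∸-monoʳ-≤ n d≤r))
      where
      d≤r : suc (x ∸ suc e) ≤ r
      d≤r = +-cancelˡ-≤ e _ r (≤-trans (≤-reflexive (trans (+-suc e _) (m+[n∸m]≡n e<x))) le)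

  -- Arcs of a k-wise intersecting family in an ordering

  Σ-below : ∀ {c n} → c ≤ n → Σ< n (below c) ≡ c
  Σ-below {c} {n} c≤n = begin
    Σ< n (below c)                                                ≡⟨ cong (λ l → Σ< l (below c)) (sym (m+[n∸m]≡n c≤n)) ⟩
    Σ< (c + (n ∸ c)) (below c)                                    ≡⟨ Σ<-split c (n ∸ c) (below c) ⟩
    Σ< c (below c) + Σ< (n ∸ c) (λ i → below c (c + i))           ≡⟨ cong₂ _+_
        (trans (Σ<-cong c λ i i<c → below-yes i<c) (trans (Σ<-const c 1) (*-identityʳ c)))
        (trans (Σ<-cong (n ∸ c) λ i _ → below-no (m+n≮m c i)) (trans (Σ<-const (n ∸ c) 0) (*-zeroʳ (n ∸ c)))) ⟩
    c + 0                                                         ≡⟨ +-identityʳ c ⟩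
    c ∎
    where open ≡-Reasoning

  Σ-not : ∀ n (b : ℕ → Bool) → Σ< n (𝟙 ∘ not ∘ b) + Σ< n (𝟙 ∘ b) ≡ n
  Σ-not n b = begin
    Σ< n (𝟙 ∘ not ∘ b) + Σ< n (𝟙 ∘ b)      ≡⟨ +-comm (Σ< n (𝟙 ∘ not ∘ b)) _ ⟩
    Σ< n (𝟙 ∘ b) + Σ< n (𝟙 ∘ not ∘ b)      ≡⟨ sym (Σ<-+ n (𝟙 ∘ b) (𝟙 ∘ not ∘ b)) ⟩
    Σ< n (λ i → 𝟙 (b i) + 𝟙 (not (b i)))   ≡⟨ Σ<-cong n (λ i _ → 𝟙-not (b i)) ⟩
    Σ< n (λ _ → 1)                         ≡⟨ trans (Σ<-const n 1) (*-identityʳ n) ⟩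
    n ∎
    where open ≡-Reasoning

  module Orderings (n m r k : ℕ) (m+r≡n : m + r ≡ n) (0<m : 0 < m) (0<r : 0 < r) (n<km : n < k * m)
                   (𝓕 : List (Subset n)) (kwise : KWiseIntersecting k 𝓕) where

    in𝓕 : List (Fin n) → ℕ → Bool
    in𝓕 σ x = does (arc m x σ ∈𝓕? 𝓕)

    private
      m≤n : m ≤ n
      m≤n = ≤-trans (m≤m+n m r) (≤-reflexive m+r≡n)

      r<n : r < n
      r<n = ≤-trans (+-monoˡ-≤ r 0<m) (≤-reflexive m+r≡n)

      starts : ∀ {b l x y} → Chain b m l x y → Fin l → ℕ
      starts (one {x} _)            _        = x
      starts (step {z = z} _ _ _ _) fzero    = z
      starts (step c _ _ _)         (fsuc i) = starts c i

      starts-hit : ∀ {b l x y} (c : Chain b m l x y) i → b (starts c i) ≡ true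
      starts-hit (one bx)        _        = bx
      starts-hit (step _ _ _ bz) fzero    = bz
      starts-hit (step c _ _ _)  (fsuc i) = starts-hit c i

      chain-≤ : ∀ {b l x y} → Chain b m l x y → x ≤ y
      chain-≤ (one _)          = ≤-refl
      chain-≤ (step c y≤z _ _) = ≤-trans (chain-≤ c) y≤z

    module _ {σ : List (Fin n)} (ord : Ordering σ) where

      private
        -- Seen from x, a common element lies past the complements treated so far. As there is no
        -- gap, it lies at or after the start of the next one, and membership in that arc pushes it
        -- past that complement as well. The cycle has only n places, whence `uncovered`.
        common-beyond : ∀ {b l x y v e} (c : Chain b m l x y) → (∀ i → v ∈ₛ arc m (starts c i) σ) →
          At (rots x σ) e v → y + m ≤ x + e
        common-beyond {x = x} (one _) v∈ p = +-monoʳ-≤ x (arc-forward⁻ m+r≡n (rots-ordering x ord) {0} p z≤n (v∈ fzero))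
        common-beyond {x = x} {v = v} {e} (step {y = y} {z} c y≤z z≤y+m bz) v∈ p = begin
          z + m              ≡⟨ cong (_+ m) (sym z≡) ⟩
          x + d + m          ≡⟨ +-assoc x d m ⟩
          x + (d + m)        ≤⟨ +-monoʳ-≤ x (arc-forward⁻ m+r≡n (rots-ordering x ord) p d≤e
                                  (subst (λ ys → v ∈ₛ setOf (drop m ys)) (trans (cong (λ w → rots w σ) (sym z≡)) (rots-+ x d σ)) (v∈ fzero))) ⟩
          x + e ∎
          where
          open ≤-Reasoning
          d = z ∸ x
          z≡ : x + d ≡ z
          z≡ = m+[n∸m]≡n (≤-trans (chain-≤ c) y≤z)
          d≤e : d ≤ e
          d≤e = +-cancelˡ-≤ x d e (begin
            x + d     ≡⟨ z≡ ⟩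
            z         ≤⟨ z≤y+m ⟩
            y + m     ≤⟨ common-beyond c (v∈ ∘ fsuc) p ⟩
            x + e ∎)

      uncovered : ∀ {x y} → Chain (in𝓕 σ) m k x y → y + m < x + n
      uncovered {x} c with kwise (λ i → arc m (starts c i) σ) (λ i → does-true (_ ∈𝓕? 𝓕) (starts-hit c i))
      ... | v , v∈ with ordering-at (rots-ordering x ord) v
      ...   | e , p = ≤-<-trans (common-beyond c v∈ p) (+-monoʳ-< x (subst (e <_) (ordering-length (rots-ordering x ord)) (at-< p)))

      module _ (b0 : in𝓕 σ 0 ≡ true) where

        open Cycle n m k 0<m m≤n n<km (in𝓕 σ) b0
          (trans (cong (λ B → does (B ∈𝓕? 𝓕)) (arc-period m ord)) b0) uncovered

        hits≤r-from : hits m 𝓕 σ ≤ r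
        hits≤r-from = +-cancelˡ-≤ m _ r (begin
          m + hits m 𝓕 σ                           ≤⟨ +-monoˡ-≤ _ m≤missing ⟩
          Σ< n (𝟙 ∘ not ∘ in𝓕 σ) + hits m 𝓕 σ      ≡⟨ Σ-not n (in𝓕 σ) ⟩
          n                                        ≡⟨ sym m+r≡n ⟩
          m + r ∎)
          where open ≤-Reasoning

        -- The witness v stands at the last place y + m ∸ 1 of the window of missing indices. The
        -- complement [x, x + m) contains this place exactly when x lies in the window, so every arc
        -- that belongs to 𝓕 contains v.
        saturated-from : r ≤ hits m 𝓕 σ → ∃ λ v → r ≤ hits m (star 𝓕 v) σ
        saturated-from r≤hits with ∃missing-window missing≤m
          where
          open ≤-Reasoning
          missing≤m : Σ< n (𝟙 ∘ not ∘ in𝓕 σ) ≤ m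
          missing≤m = +-cancelʳ-≤ r _ m (begin
            Σ< n (𝟙 ∘ not ∘ in𝓕 σ) + r             ≤⟨ +-monoʳ-≤ _ r≤hits ⟩
            Σ< n (𝟙 ∘ not ∘ in𝓕 σ) + hits m 𝓕 σ    ≡⟨ Σ-not n (in𝓕 σ) ⟩
            n                                      ≡⟨ sym m+r≡n ⟩
            m + r ∎)
        ... | y , window with at-∃ σ {y + (m ∸ 1)} (subst (y + (m ∸ 1) <_) (sym (ordering-length ord)) (proj₁ (window (m ∸ 1) m-1<m)))
          where
          m-1<m : m ∸ 1 < m
          m-1<m = ≤-reflexive (m+[n∸m]≡n 0<m)
        ...   | v , p = v , ≤-trans r≤hits (Σ<-mono n λ x x<n → 𝟙-mono (arc m x σ ∈𝓕? 𝓕) (arc m x σ ∈𝓕? star 𝓕 v)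
                          λ A∈𝓕 → ∈-filter⁺ (v ∈?_) A∈𝓕 (v∈arc x x<n A∈𝓕))
          where
          open ≤-Reasoning
          v∈arc : ∀ x → x < n → arc m x σ ∈ₗ 𝓕 → v ∈ₛ arc m x σ
          v∈arc x x<n A∈𝓕 with x <? y
          ... | yes x<y = arc-forward⁺ {m = m} {r} m+r≡n ord {x} p (begin
            x + m               ≡⟨ cong (x +_) (sym (m+[n∸m]≡n 0<m)) ⟩
            x + suc (m ∸ 1)     ≡⟨ +-suc x _ ⟩
            suc x + (m ∸ 1)     ≤⟨ +-monoˡ-≤ (m ∸ 1) x<y ⟩
            y + (m ∸ 1) ∎)
          ... | no x≮y with x <? y + m
          ...   | yes x<y+m = contradiction (trans (sym (dec-true (arc m x σ ∈𝓕? 𝓕) A∈𝓕))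
                    (trans (cong (in𝓕 σ) (sym (m+[n∸m]≡n (≮⇒≥ x≮y))))
                           (proj₂ (window (x ∸ y) (+-cancelˡ-< y _ _ (subst (_< y + m) (sym (m+[n∸m]≡n (≮⇒≥ x≮y))) x<y+m)))))) λ ()
          ...   | no x≮y+m = arc-wrap⁺ {m = m} {r} m+r≡n ord {x} p
                    (≤-trans (≤-reflexive (trans (sym (+-suc y _)) (cong (y +_) (m+[n∸m]≡n 0<m)))) (≮⇒≥ x≮y+m))
                    (<⇒≤ x<n) (≤-pred (begin
            suc x                   ≤⟨ x<n ⟩
            n                       ≡⟨ sym m+r≡n ⟩
            m + r                   ≡⟨ cong (_+ r) (sym (m+[n∸m]≡n 0<m)) ⟩
            suc (m ∸ 1 + r)         ≤⟨ s≤s (+-monoˡ-≤ r (m≤n+m (m ∸ 1) y)) ⟩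
            suc (y + (m ∸ 1) + r) ∎))

    module _ {σ : List (Fin n)} (ord : Ordering σ) where

      private
        no-hits : (∀ x → x < n → not (in𝓕 σ x) ≡ true) → hits m 𝓕 σ ≡ 0
        no-hits none = trans (Σ<-cong n λ x x<n → zero-hit (in𝓕 σ x) (none x x<n)) (trans (Σ<-const n 0) (*-zeroʳ n))
          where
          zero-hit : ∀ c → not c ≡ true → 𝟙 c ≡ 0
          zero-hit false _ = refl

        hit : ∀ {c} → not c ≡ false → c ≡ true
        hit {true} _ = refl

      -- The analysis of a cycle wants a member at index 0. Rotation does not change `hits`, so any
      -- member among the arcs can be moved there, and without one the count is 0.
      hits≤r : hits m 𝓕 σ ≤ r
      hits≤r with first-below (not ∘ in𝓕 σ) n
      ... | inj₁ (x , _ , bx , _) = ≤-trans (≤-reflexive (sym (hits-rots m 𝓕 x ord))) (hits≤r-from (rots-ordering x ord) (hit bx))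
      ... | inj₂ none             = ≤-trans (≤-reflexive (no-hits none)) z≤n

      saturated : r ≤ hits m 𝓕 σ → ∃ λ v → r ≤ hits m (star 𝓕 v) σ
      saturated r≤hits with first-below (not ∘ in𝓕 σ) n
      ... | inj₁ (x , _ , bx , _) with saturated-from (rots-ordering x ord) (hit bx) (≤-trans r≤hits (≤-reflexive (sym (hits-rots m 𝓕 x ord))))
      ...   | v , le = v , ≤-trans le (≤-reflexive (hits-rots m (star 𝓕 v) x ord))
      saturated r≤hits | inj₂ none = contradiction (≤-trans 0<r (≤-trans r≤hits (≤-reflexive (no-hits none)))) λ ()

    -- Transposing neighbours in an ordering centred at its first entry

    module _ {v : Fin n} {ρ : List (Fin n)} (ord : Ordering (v ∷ ρ)) (sat : r ≤ hits m (star 𝓕 v) (v ∷ ρ)) where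

      private
        σ : List (Fin n)
        σ = v ∷ ρ

      -- With v at place 0 the arcs through v have the indices 1, ..., r, of which `g` is the
      -- indicator. The star has at least r hits, all among these indices, so none of them is
      -- absent.
      arc∈𝓕 : ∀ {x} → 0 < x → x ≤ r → arc m x σ ∈ₗ 𝓕
      arc∈𝓕 {suc x} _ x<r = proj₁ (∈-filter⁻ (v ∈?_) (does-true (arc m (suc x) σ ∈𝓕? star 𝓕 v)
        (𝟙-pos _ (≤-trans (≤-reflexive (sym (below-yes x<r))) (Σ<-tight n f≤g (≤-trans (≤-reflexive (Σ-g n r<n)) sat) (≤-<-trans x<r r<n))))))
        where
        f g : ℕ → ℕ
        f x = 𝟙 (does (arc m x σ ∈𝓕? star 𝓕 v))
        g zero    = 0
        g (suc x) = below r x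
        Σ-g : ∀ l → r < l → Σ< l g ≡ r
        Σ-g (suc l) r<1+l = Σ-below (≤-pred r<1+l)
        v∈ : ∀ x → arc m x σ ∈ₗ star 𝓕 v → v ∈ₛ arc m x σ
        v∈ x A∈ = proj₂ (∈-filter⁻ (v ∈?_) {xs = 𝓕} A∈)
        f≤g : ∀ x → x < n → f x ≤ g x
        f≤g zero    _   = ≤-reflexive (cong 𝟙 (dec-false (arc m 0 σ ∈𝓕? star 𝓕 v) λ A∈ →
          <⇒≱ 0<m (arc-forward⁻ m+r≡n ord {0} here z≤n (v∈ 0 A∈))))
        f≤g (suc x) x<n with x <? r
        ... | yes x<r = ≤-trans (𝟙≤1 _) (≤-reflexive (sym (below-yes x<r)))
        ... | no  x≮r = ≤-trans (≤-reflexive (cong 𝟙 (dec-false (arc m (suc x) σ ∈𝓕? star 𝓕 v) λ A∈ →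
          x≮r (arc-wrap⁻ {m = m} m+r≡n ord {suc x} here (s≤s z≤n) (<⇒≤ x<n) (v∈ (suc x) A∈))))) z≤n

      -- The complements of the arcs z₀, z₀ + m, … (the last moved back to r) cover [z₀, z₀ + r].
      no-member-between : ∀ {B z₀} → B ∈ₗ 𝓕 → 0 < z₀ →
        (∀ w → w ∈ₛ B → ∃ λ e → At σ e w × z₀ ≤ e × e ≤ z₀ + r) → ⊥
      no-member-between {B} {z₀} B∈𝓕 0<z₀ between = clash k kwise n<km
        where
        clash : ∀ k → KWiseIntersecting k 𝓕 → n < k * m → ⊥
        clash (suc l) kwise n<km = covered (kwise G G∈𝓕)
          where
          z : ℕ → ℕ
          z i = (z₀ + i * m) ⊓ r
          G : Fin (suc l) → Subset n
          G fzero    = B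
          G (fsuc i) = arc m (z (toℕ i)) σ
          G∈𝓕 : ∀ i → G i ∈ₗ 𝓕
          G∈𝓕 fzero    = B∈𝓕
          G∈𝓕 (fsuc i) = arc∈𝓕 (⊓-glb (≤-trans 0<z₀ (m≤m+n z₀ _)) 0<r) (m⊓n≤n _ r)
          covered : (∃ λ w → ∀ i → w ∈ₛ G i) → ⊥
          covered (w , w∈) with between w (w∈ fzero)
          ... | e , p , z₀≤e , e≤z₀+r = <⇒≱ n<km (begin
            m + l * m   ≤⟨ +-monoʳ-≤ m (+-cancelˡ-≤ z₀ _ _ (≤-trans (beyond l ≤-refl) e≤z₀+r)) ⟩
            m + r       ≡⟨ m+r≡n ⟩
            n ∎)
            where
            open ≤-Reasoning
            w∈z : ∀ i → i < l → w ∈ₛ arc m (z i) σ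
            w∈z i i<l = subst (λ j → w ∈ₛ arc m (z j) σ) (toℕ-fromℕ< i<l) (w∈ (fsuc (fromℕ< i<l)))
            -- Each arc pushes the common element w on by m places. Where the index is cut down to
            -- r, w would have to lie at place r + m = n or later, which does not exist.
            beyond : ∀ i → i ≤ l → z₀ + i * m ≤ e
            beyond zero    _   = ≤-trans (≤-reflexive (+-identityʳ z₀)) z₀≤e
            beyond (suc i) i<l with z₀ + i * m ≤? r
            ... | yes le = begin
              z₀ + (m + i * m)   ≡⟨ cong (z₀ +_) (+-comm m (i * m)) ⟩
              z₀ + (i * m + m)   ≡⟨ sym (+-assoc z₀ (i * m) m) ⟩
              z₀ + i * m + m     ≤⟨ arc-forward⁻ m+r≡n ord p (beyond i (<⇒≤ i<l))
                                     (subst (λ x → w ∈ₛ arc m x σ) (m≤n⇒m⊓n≡m le) (w∈z i i<l)) ⟩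
              e ∎
            ... | no  ≰r = contradiction (begin
              n       ≡⟨ trans (sym m+r≡n) (+-comm m r) ⟩
              r + m   ≤⟨ arc-forward⁻ m+r≡n ord p (≤-trans (<⇒≤ (≰⇒> ≰r)) (beyond i (<⇒≤ i<l)))
                          (subst (λ x → w ∈ₛ arc m x σ) (m≥n⇒m⊓n≡n (<⇒≤ (≰⇒> ≰r))) (w∈z i i<l)) ⟩
              e ∎) (<⇒≱ (subst (e <_) (ordering-length ord) (at-< p)))

      swapped-ordering : ∀ p → Ordering (v ∷ swapAt p ρ)
      swapped-ordering p = ↭-trans (prep v (swapAt-↭ p ρ)) ord

      module _ (p : ℕ) where

        private
          σ′ : List (Fin n)
          σ′ = v ∷ swapAt p ρ

          ord′ : Ordering σ′
          ord′ = swapped-ordering p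

        arc-position : ∀ {x w} → r < x → x ≤ n → w ∈ₛ arc m x σ′ → ∃ λ e → At σ′ e w × x ∸ r ≤ e × e < x
        arc-position {x} {w} r<x x≤n w∈ with ordering-at ord′ w
        ... | e , q with e <? x
        ...   | yes e<x = e , q , ≤-trans (∸-monoˡ-≤ r (arc-wrap⁻ m+r≡n ord′ {x} q e<x x≤n w∈)) (≤-reflexive (m+n∸n≡m e r)) , e<x
        ...   | no  e≮x = contradiction (begin
          n       ≡⟨ trans (sym m+r≡n) (+-comm m r) ⟩
          r + m   ≤⟨ +-monoˡ-≤ m (<⇒≤ r<x) ⟩
          x + m   ≤⟨ arc-forward⁻ m+r≡n ord′ {x} q (≮⇒≥ e≮x) w∈ ⟩
          e ∎) (<⇒≱ (subst (e <_) (ordering-length ord′) (at-< q)))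
          where open ≤-Reasoning

        -- An arc avoiding v occupies r consecutive places after v; transposing two adjacent
        -- entries other than v moves it into r + 1 consecutive places.
        arc-between : ∀ {x} → r < x → x ≤ n → ∃ λ z₀ → 0 < z₀ ×
          (∀ w → w ∈ₛ arc m x σ′ → ∃ λ e → At σ e w × z₀ ≤ e × e ≤ z₀ + r)
        -- As v takes place 0, the transposed places of σ are p + 1 and p + 2. Only an arc that
        -- begins at p + 2 gains a place on the left; any other gain is on the right, at place x.
        arc-between {x} r<x x≤n with x ∸ r ≟ suc (suc p)
        ... | yes lo≡ = suc p , s≤s z≤n , λ w w∈ → move (arc-position r<x x≤n w∈)
          where
          x≡ : x ≡ suc (suc p + r)
          x≡ = trans (sym (m∸n+n≡m (<⇒≤ r<x))) (cong (_+ r) lo≡)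
          move : ∀ {w} → (∃ λ e′ → At σ′ e′ w × x ∸ r ≤ e′ × e′ < x) → ∃ λ e → At σ e w × suc p ≤ e × e ≤ suc p + r
          move (_ , here , lo≤e′ , _) = contradiction (≤-trans (≤-reflexive (sym lo≡)) lo≤e′) λ ()
          move (suc i , there q , lo≤e′ , e′<x) with at-swapAt p q
          ... | inj₁ (refl , q′)        = contradiction (≤-trans (≤-reflexive (sym lo≡)) lo≤e′) (<⇒≱ ≤-refl)
          ... | inj₂ (inj₁ (refl , q′)) = suc p , there q′ , ≤-refl , m≤m+n _ r
          ... | inj₂ (inj₂ q′)          = suc i , there q′ , <⇒≤ (≤-trans (≤-reflexive (sym lo≡)) lo≤e′) ,
                                          ≤-pred (≤-trans e′<x (≤-reflexive x≡))
        ... | no lo≢ = x ∸ r , m<n⇒0<n∸m r<x , λ w w∈ → move (arc-position r<x x≤n w∈)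
          where
          lo+r≡x : x ∸ r + r ≡ x
          lo+r≡x = m∸n+n≡m (<⇒≤ r<x)
          move : ∀ {w} → (∃ λ e′ → At σ′ e′ w × x ∸ r ≤ e′ × e′ < x) → ∃ λ e → At σ e w × x ∸ r ≤ e × e ≤ x ∸ r + r
          move (_ , here , lo≤e′ , _) = contradiction lo≤e′ (<⇒≱ (m<n⇒0<n∸m r<x))
          move (suc i , there q , lo≤e′ , e′<x) with at-swapAt p q
          ... | inj₁ (refl , q′)        = suc (suc p) , there q′ , m≤n⇒m≤1+n lo≤e′ , ≤-trans e′<x (≤-reflexive (sym lo+r≡x))
          ... | inj₂ (inj₁ (refl , q′)) = suc p , there q′ , ≤-pred (≤∧≢⇒< lo≤e′ lo≢) ,
                                          ≤-trans (<⇒≤ (<-trans (n<1+n _) e′<x)) (≤-reflexive (sym lo+r≡x))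
          ... | inj₂ (inj₂ q′)          = suc i , there q′ , lo≤e′ , ≤-trans (<⇒≤ e′<x) (≤-reflexive (sym lo+r≡x))

        v∈arc-from-1 : ∀ {x} → 0 < x → x ≤ n → arc m x σ′ ∈ₗ 𝓕 → v ∈ₛ arc m x σ′
        v∈arc-from-1 {x} 0<x x≤n A∈𝓕 with x ≤? r
        ... | yes x≤r = arc-wrap⁺ m+r≡n ord′ {x} here 0<x x≤n x≤r
        ... | no  x≰r with arc-between (≰⇒> x≰r) x≤n
        ...   | z₀ , 0<z₀ , between = ⊥-elim (no-member-between A∈𝓕 0<z₀ between)

        v∈arc : ∀ x → x < n → arc m x σ′ ∈ₗ 𝓕 → v ∈ₛ arc m x σ′
        -- Index 0 gives the same arc as index n, to which the case of positive index applies.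
        v∈arc zero    _   A∈𝓕 = subst (v ∈ₛ_) (arc-period m ord′)
          (v∈arc-from-1 (≤-<-trans z≤n r<n) ≤-refl (subst (_∈ₗ 𝓕) (sym (arc-period m ord′)) A∈𝓕))
        v∈arc (suc x) x<n A∈𝓕 = v∈arc-from-1 (s≤s z≤n) (<⇒≤ x<n) A∈𝓕

        hits-star-swapAt : hits m 𝓕 σ′ ≤ hits m (star 𝓕 v) σ′
        hits-star-swapAt = Σ<-mono n λ x x<n → 𝟙-mono (arc m x σ′ ∈𝓕? 𝓕) (arc m x σ′ ∈𝓕? star 𝓕 v)
          λ A∈𝓕 → ∈-filter⁺ (v ∈?_) A∈𝓕 (v∈arc x x<n A∈𝓕)

  -- Double counting

  Unique-resp-↭ : ∀ {A : Set} {xs ys : List A} → xs ↭ ys → Unique xs → Unique ys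
  Unique-resp-↭ {A} p = SetoidPermutation.Unique-resp-↭ (setoid A) (↭⇒↭ₛ p)

  drop-⊆ : ∀ m {A : Set} {xs : List A} {y} → y ∈ₗ drop m xs → y ∈ₗ xs
  drop-⊆ zero    p = p
  drop-⊆ (suc m) {xs = x ∷ xs} p = there (drop-⊆ m p)

  module _ {n : ℕ} where

    _≟ₛ_ : (A B : Subset n) → Dec (A ≡ B)
    _≟ₛ_ = ≡-dec Bool._≟_

    setOf-↭ : ∀ {xs ys : List (Fin n)} → xs ↭ ys → setOf xs ≡ setOf ys
    setOf-↭ {xs} {ys} p = ⊆-antisym (λ v∈ → ∈-setOf⁺ (∈-resp-↭ p (∈-setOf⁻ xs v∈)))
                                     (λ v∈ → ∈-setOf⁺ (∈-resp-↭ (↭-sym p) (∈-setOf⁻ ys v∈)))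

    -- An entry of `as` in first place would be absent from the final segment, so only the entries
    -- of `bs` can come first, and each contributes by induction.
    perm∑-dropping : ∀ m r (bs as : List (Fin n)) → length bs ≡ m → length as ≡ r → Unique (bs ++ as) →
      perm∑ (m + r) (λ σ → 𝟙 (does (setOf (drop m σ) ≟ₛ setOf as))) (bs ++ as) ≡ m ! * r !
    perm∑-dropping zero r [] as _ |as| u = begin
      perm∑ r (λ σ → 𝟙 (does (setOf σ ≟ₛ setOf as))) as
        ≡⟨ perm∑-cong r as |as| (λ σ p → cong 𝟙 (dec-true (setOf σ ≟ₛ setOf as) (setOf-↭ p))) ⟩
      perm∑ r (λ _ → 1) as  ≡⟨ perm∑-const r 1 as |as| ⟩
      r ! * 1               ≡⟨ *-comm (r !) 1 ⟩
      1 * r ! ∎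
      where open ≡-Reasoning
    perm∑-dropping (suc m) r bs as |bs| |as| u = begin
      perm∑ (suc m + r) (λ σ → 𝟙 (does (setOf (drop (suc m) σ) ≟ₛ setOf as))) (bs ++ as)
        ≡⟨ sel-++ (λ y ys → perm∑ (m + r) g ys) bs as ⟩
      sel (λ y ys → perm∑ (m + r) g (ys ++ as)) bs + sel (λ y ys → perm∑ (m + r) g (bs ++ ys)) as
        ≡⟨ cong₂ _+_
            (sel-cong bs λ y ys p → perm∑-dropping m r ys as (suc-injective (trans (↭-length p) |bs|)) |as|
              (tail (Unique-resp-↭ (↭-sym (++⁺ʳ as p)) u)))
            (sel-cong as λ y ys p → trans
              (perm∑-cong (m + r) (bs ++ ys) (len y ys p) λ zs q →
                cong 𝟙 (dec-false (setOf (drop m zs) ≟ₛ setOf as) λ e → y∉ y ys p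
                  (∈-resp-↭ q (drop-⊆ m (∈-setOf⁻ _ (subst (y ∈ₛ_) (sym e) (∈-setOf⁺ (∈-resp-↭ p (here refl)))))))))
              (perm∑-zero (m + r) (bs ++ ys))) ⟩
      sel (λ _ _ → m ! * r !) bs + sel (λ _ _ → 0) as
        ≡⟨ cong₂ _+_ (trans (sel-const _ bs) (cong (_* (m ! * r !)) |bs|)) (trans (sel-const 0 as) (*-zeroʳ (length as))) ⟩
      suc m * (m ! * r !) + 0
        ≡⟨ trans (+-identityʳ _) (sym (*-assoc (suc m) (m !) (r !))) ⟩
      suc m ! * r ! ∎
      where
      open ≡-Reasoning
      g : List (Fin n) → ℕ
      g σ = 𝟙 (does (setOf (drop m σ) ≟ₛ setOf as))
      tail : ∀ {y : Fin n} {ys} → Unique (y ∷ ys) → Unique ys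
      tail (_ ∷ u) = u
      moved : ∀ y ys → y ∷ ys ↭ as → bs ++ as ↭ y ∷ bs ++ ys
      moved y ys p = ↭-trans (++⁺ˡ bs (↭-sym p)) (shift y bs ys)
      y∉ : ∀ y ys → y ∷ ys ↭ as → ¬ y ∈ₗ bs ++ ys
      y∉ y ys p = Unique[x∷xs]⇒x∉xs (Unique-resp-↭ (moved y ys p) u)
      len : ∀ y ys → y ∷ ys ↭ as → length (bs ++ ys) ≡ m + r
      len y ys p = suc-injective (trans (sym (↭-length (moved y ys p)))
        (trans (length-++ bs) (cong₂ _+_ |bs| |as|)))

  elems : ∀ {n} → Subset n → List (Fin n)
  elems []          = []
  elems (true ∷ A)  = fzero ∷ map fsuc (elems A)
  elems (false ∷ A) = map fsuc (elems A)

  length-elems : ∀ {n} (A : Subset n) → length (elems A) ≡ ∣ A ∣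
  length-elems []          = refl
  length-elems (true ∷ A)  = cong suc (trans (length-map fsuc (elems A)) (length-elems A))
  length-elems (false ∷ A) = trans (length-map fsuc (elems A)) (length-elems A)

  ∈-elems⁺ : ∀ {n} {A : Subset n} {v} → v ∈ₛ A → v ∈ₗ elems A
  ∈-elems⁺ {A = true ∷ A}  here      = here refl
  ∈-elems⁺ {A = true ∷ A}  (there p) = there (∈-map⁺ fsuc (∈-elems⁺ p))
  ∈-elems⁺ {A = false ∷ A} (there p) = ∈-map⁺ fsuc (∈-elems⁺ p)

  ∈-elems⁻ : ∀ {n} {A : Subset n} {v} → v ∈ₗ elems A → v ∈ₛ A
  ∈-elems⁻ {A = true ∷ A}  (here refl) = here
  ∈-elems⁻ {A = true ∷ A}  (there p) with ∈-map⁻ fsuc p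
  ... | w , q , refl = there (∈-elems⁻ q)
  ∈-elems⁻ {A = false ∷ A} p with ∈-map⁻ fsuc p
  ... | w , q , refl = there (∈-elems⁻ q)

  setOf-elems : ∀ {n} (A : Subset n) → setOf (elems A) ≡ A
  setOf-elems A = ⊆-antisym (λ v∈ → ∈-elems⁻ (∈-setOf⁻ (elems A) v∈)) (λ v∈ → ∈-setOf⁺ (∈-elems⁺ v∈))

  elems-∁-↭ : ∀ {n} (A : Subset n) → elems (∁ A) ++ elems A ↭ allFin n
  elems-∁-↭ []          = ↭-refl
  elems-∁-↭ {suc n} (s ∷ A) = ↭-trans (front s) (prep fzero (subst (map fsuc (elems (∁ A) ++ elems A) ↭_) (map-tabulate (λ i → i) fsuc)
    (map⁺ fsuc (elems-∁-↭ A))))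
    where
    front : ∀ s → elems (∁ (s ∷ A)) ++ elems (s ∷ A) ↭ fzero ∷ map fsuc (elems (∁ A) ++ elems A)
    front true  = subst (λ ys → map fsuc (elems (∁ A)) ++ fzero ∷ map fsuc (elems A) ↭ fzero ∷ ys)
      (sym (map-++ fsuc (elems (∁ A)) (elems A))) (shift fzero (map fsuc (elems (∁ A))) (map fsuc (elems A)))
    front false = prep fzero (subst (map fsuc (elems (∁ A)) ++ map fsuc (elems A) ↭_) (sym (map-++ fsuc (elems (∁ A)) (elems A))) ↭-refl)

  𝟙-∈ : ∀ {n} {𝓖 : List (Subset n)} → Unique 𝓖 → ∀ B → 𝟙 (does (B ∈𝓕? 𝓖)) ≡ Σₗ 𝓖 (λ A → 𝟙 (does (B ≟ₛ A)))
  𝟙-∈ []                      B = refl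
  𝟙-∈ {𝓖 = A ∷ 𝓖} (A∉ ∷ u) B with B ≟ₛ A
  ... | yes refl = cong suc (sym (absent A∉))
    where
    absent : ∀ {𝓗} → All (B ≢_) 𝓗 → Σₗ 𝓗 (λ A → 𝟙 (does (B ≟ₛ A))) ≡ 0
    absent []                  = refl
    absent {A ∷ _} (B≢A ∷ B∉) = cong₂ _+_ (cong 𝟙 (dec-false (B ≟ₛ A) B≢A)) (absent B∉)
  ... | no _     = 𝟙-∈ u B

  Σₗ-const-on : ∀ {A : Set} {xs : List A} {f : A → ℕ} {c} → All (λ x → f x ≡ c) xs → Σₗ xs f ≡ length xs * c
  Σₗ-const-on []       = refl
  Σₗ-const-on (p ∷ ps) = cong₂ _+_ p (Σₗ-const-on ps)

  Σₗ-term : ∀ {A : Set} {xs : List A} (f : A → ℕ) {v} → v ∈ₗ xs → f v ≤ Σₗ xs f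
  Σₗ-term f (here refl)        = m≤m+n _ _
  Σₗ-term {xs = x ∷ _} f (there p) = ≤-trans (Σₗ-term f p) (m≤n+m _ (f x))

  Σ<-*ʳ : ∀ n (f : ℕ → ℕ) c → Σ< n (λ i → f i * c) ≡ Σ< n f * c
  Σ<-*ʳ zero    f c = refl
  Σ<-*ʳ (suc n) f c = trans (cong (f 0 * c +_) (Σ<-*ʳ n (f ∘ suc) c)) (sym (*-distribʳ-+ c (f 0) _))

  perm∑-rots : ∀ {A : Set} n x (g : List A → ℕ) xs → perm∑ n (g ∘ rots x) xs ≡ perm∑ n g xs
  perm∑-rots n zero    g xs = refl
  perm∑-rots n (suc x) g xs = trans (perm∑-rot n (g ∘ rots x) xs) (perm∑-rots n x g xs)

  module _ {n m r : ℕ} (m+r≡n : m + r ≡ n) where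

    perm∑-arc : ∀ A → ∣ A ∣ ≡ r → perm∑ n (λ σ → 𝟙 (does (setOf (drop m σ) ≟ₛ A))) (allFin n) ≡ m ! * r !
    perm∑-arc A |A| = begin
      perm∑ n (λ σ → 𝟙 (does (setOf (drop m σ) ≟ₛ A))) (allFin n)
        ≡⟨ perm∑-↭ n _ (↭-sym (elems-∁-↭ A)) ⟩
      perm∑ n (λ σ → 𝟙 (does (setOf (drop m σ) ≟ₛ A))) (bs ++ as)
        ≡⟨ cong₂ (λ l B → perm∑ l (λ σ → 𝟙 (does (setOf (drop m σ) ≟ₛ B))) (bs ++ as)) (sym m+r≡n) (sym (setOf-elems A)) ⟩
      perm∑ (m + r) (λ σ → 𝟙 (does (setOf (drop m σ) ≟ₛ setOf as))) (bs ++ as)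
        ≡⟨ perm∑-dropping m r bs as |bs| |as| (Unique-resp-↭ (↭-sym (elems-∁-↭ A)) (allFin⁺ n)) ⟩
      m ! * r ! ∎
      where
      open ≡-Reasoning
      as = elems A
      bs = elems (∁ A)
      |as| : length as ≡ r
      |as| = trans (length-elems A) |A|
      |bs| : length bs ≡ m
      |bs| = +-cancelʳ-≡ r _ m (trans (cong (length bs +_) (sym |as|)) (trans (sym (length-++ bs))
        (trans (ordering-length (elems-∁-↭ A)) (sym m+r≡n))))

    -- Rotating brings any index to 0 without changing the sum over orderings, and each member is
    -- the arc at index 0 in m! r! of them.
    perm∑-hits : ∀ {𝓖} → IsUniformFamily n r 𝓖 → perm∑ n (hits m 𝓖) (allFin n) ≡ n * (length 𝓖 * (m ! * r !))
    perm∑-hits {𝓖} (u , uniform) = begin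
      perm∑ n (hits m 𝓖) (allFin n)
        ≡⟨ perm∑-Σ< n n (λ x σ → 𝟙 (does (arc m x σ ∈𝓕? 𝓖))) (allFin n) ⟩
      Σ< n (λ x → perm∑ n (λ σ → 𝟙 (does (arc m x σ ∈𝓕? 𝓖))) (allFin n))
        ≡⟨ Σ<-cong n (λ x _ → perm∑-rots n x (λ σ → 𝟙 (does (setOf (drop m σ) ∈𝓕? 𝓖))) (allFin n)) ⟩
      Σ< n (λ _ → perm∑ n (λ σ → 𝟙 (does (setOf (drop m σ) ∈𝓕? 𝓖))) (allFin n))
        ≡⟨ Σ<-const n _ ⟩
      n * perm∑ n (λ σ → 𝟙 (does (setOf (drop m σ) ∈𝓕? 𝓖))) (allFin n)
        ≡⟨ cong (n *_) (trans (perm∑-ext n (allFin n) λ σ → 𝟙-∈ u (setOf (drop m σ)))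
             (trans (perm∑-Σₗ n 𝓖 (λ A σ → 𝟙 (does (setOf (drop m σ) ≟ₛ A))) (allFin n))
                    (Σₗ-const-on (All.map (λ {A} → perm∑-arc A) uniform)))) ⟩
      n * (length 𝓖 * (m ! * r !)) ∎
      where open ≡-Reasoning

  module _ {A : Set} (h : A → ℕ) where

    atHead : List A → ℕ
    atHead []      = 0
    atHead (x ∷ _) = h x

    Σ-atHead-++ : ∀ ys xs → Σ< (length ys) (λ i → atHead (rots i (ys ++ xs))) ≡ Σₗ ys h
    Σ-atHead-++ []       xs = refl
    Σ-atHead-++ (y ∷ ys) xs = cong (h y +_) (trans
      (Σ<-cong (length ys) λ i _ → cong (atHead ∘ rots i) (++-assoc ys xs (y ∷ [])))
      (Σ-atHead-++ ys (xs ++ y ∷ [])))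

    Σ-atHead : ∀ xs → Σ< (length xs) (λ i → atHead (rots i xs)) ≡ Σₗ xs h
    Σ-atHead xs = trans (Σ<-cong (length xs) λ i _ → cong (atHead ∘ rots i) (sym (++-identityʳ xs))) (Σ-atHead-++ xs [])

  module _ {n : ℕ} {v : Fin (suc n)} {τ : List (Fin (suc n))} (ord : Ordering (v ∷ τ)) where

    private
      isv : Fin (suc n) → ℕ
      isv x = 𝟙 (does (x ≟ᶠ v))

      isv-v : isv v ≡ 1
      isv-v = cong 𝟙 (dec-true (v ≟ᶠ v) refl)

      v∉τ : ∀ {x} → x ∈ₗ τ → isv x ≡ 0
      v∉τ {x} x∈τ = cong 𝟙 (dec-false (x ≟ᶠ v) λ { refl → Unique[x∷xs]⇒x∉xs (ordering-unique ord) x∈τ })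

      Σ-isv : ∀ {σ : List (Fin (suc n))} → Ordering σ → Σₗ σ isv ≡ 1
      Σ-isv p = trans (Σₗ-↭ (↭-trans p (↭-sym ord)) isv)
        (cong₂ _+_ isv-v (trans (Σₗ-const-on {c = 0} (All.tabulate v∉τ)) (*-zeroʳ (length τ))))

    -- Among the rotations of an ordering exactly one begins with v.
    perm∑-rotation-invariant : ∀ (g : List (Fin (suc n)) → ℕ) → (∀ {σ} → Ordering σ → g (rot σ) ≡ g σ) →
      perm∑ (suc n) g (allFin (suc n)) ≡ suc n * perm∑ n (g ∘ (v ∷_)) τ
    perm∑-rotation-invariant g g-rot = begin
      perm∑ N g (allFin N)
        ≡⟨ perm∑-cong N (allFin N) (length-tabulate (λ i → i)) (λ σ p → trans (sym (*-identityˡ (g σ)))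
             (trans (cong (_* g σ) (sym (trans (cong (λ l → Σ< l (λ i → atHead isv (rots i σ))) (sym (ordering-length p))) (trans (Σ-atHead isv σ) (Σ-isv p)))))
             (trans (sym (Σ<-*ʳ N (λ i → atHead isv (rots i σ)) (g σ)))
                    (Σ<-cong N λ i _ → cong (atHead isv (rots i σ) *_) (sym (g-rots i p)))))) ⟩
      perm∑ N (λ σ → Σ< N (λ i → f (rots i σ))) (allFin N)
        ≡⟨ perm∑-Σ< N N (λ i σ → f (rots i σ)) (allFin N) ⟩
      Σ< N (λ i → perm∑ N (f ∘ rots i) (allFin N))
        ≡⟨ Σ<-cong N (λ i _ → perm∑-rots N i f (allFin N)) ⟩
      Σ< N (λ _ → perm∑ N f (allFin N))
        ≡⟨ Σ<-const N _ ⟩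
      N * perm∑ N f (allFin N)
        ≡⟨ cong (N *_) (trans (perm∑-↭ N f (↭-sym ord)) at-v) ⟩
      N * perm∑ n (g ∘ (v ∷_)) τ ∎
      where
      open ≡-Reasoning
      N = suc n
      f : List (Fin N) → ℕ
      f σ = atHead isv σ * g σ
      g-rots : ∀ i {σ} → Ordering σ → g (rots i σ) ≡ g σ
      g-rots zero    p = refl
      g-rots (suc i) {σ} p = trans (g-rots i (↭-trans (rot-↭ σ) p)) (g-rot p)
      at-v : perm∑ N f (v ∷ τ) ≡ perm∑ n (g ∘ (v ∷_)) τ
      at-v = trans (cong₂ _+_
        (perm∑-ext n τ λ ρ → trans (cong (_* g (v ∷ ρ)) isv-v) (*-identityˡ _))
        (trans (sel-cong τ λ y ys p → trans (perm∑-ext n (v ∷ ys) λ ρ → cong (_* g (y ∷ ρ)) (v∉τ (∈-resp-↭ p (here refl))))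
                 (perm∑-zero n (v ∷ ys)))
               (trans (sel-const 0 τ) (*-zeroʳ (length τ)))))
        (+-identityʳ _)

  -- Stability

  module _ {n m r k : ℕ} (m+r≡n : m + r ≡ suc n) (0<m : 0 < m) (0<r : 0 < r) (n<km : suc n < k * m)
           {𝓕 : List (Subset (suc n))} (uniform : IsUniformFamily (suc n) r 𝓕) (kwise : KWiseIntersecting k 𝓕) where

    private
      N : ℕ
      N = suc n

      Ω : (List (Fin N) → ℕ) → ℕ
      Ω g = perm∑ N g (allFin N)

      |allFin| : length (allFin N) ≡ N
      |allFin| = length-tabulate (λ i → i)

      -- The number of orderings in which a given member is the arc at a given index.
      K : ℕ
      K = m ! * r !

    open Orderings N m r k m+r≡n 0<m 0<r n<km 𝓕 kwise

    unsaturated : List (Fin N) → ℕ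
    unsaturated σ = 𝟙 (does (hits m 𝓕 σ <? r))

    centred : Fin N → List (Fin N) → Bool
    centred v σ = does (r ≤? hits m (star 𝓕 v) σ)

    unsaturated-rot : ∀ {σ} → Ordering σ → unsaturated (rot σ) ≡ unsaturated σ
    unsaturated-rot ord = cong (λ h → 𝟙 (does (h <? r))) (hits-rot m 𝓕 ord)

    hits+unsaturated≤r : ∀ {σ} → Ordering σ → hits m 𝓕 σ + unsaturated σ ≤ r
    hits+unsaturated≤r {σ} ord = fits (hits m 𝓕 σ <? r)
      where
      fits : (d : Dec (hits m 𝓕 σ < r)) → hits m 𝓕 σ + 𝟙 (does d) ≤ r
      fits (yes h<r) = ≤-trans (≤-reflexive (+-comm _ 1)) h<r
      fits (no  _)   = ≤-trans (≤-reflexive (+-identityʳ _)) (hits≤r ord)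

    centred-or-unsaturated : ∀ {σ} → Ordering σ → 1 ≤ Σₗ (allFin N) (λ v → 𝟙 (centred v σ)) + unsaturated σ
    centred-or-unsaturated {σ} ord = either (hits m 𝓕 σ <? r)
      where
      either : (d : Dec (hits m 𝓕 σ < r)) → 1 ≤ Σₗ (allFin N) (λ v → 𝟙 (centred v σ)) + 𝟙 (does d)
      either (yes _)   = m≤n+m 1 _
      either (no h≮r) with saturated ord (≮⇒≥ h≮r)
      ... | v , le = ≤-trans (≤-trans (≤-reflexive (sym (cong 𝟙 (dec-true (r ≤? hits m (star 𝓕 v) σ) le))))
                       (Σₗ-term (λ v → 𝟙 (centred v σ)) (∈-allFin v))) (m≤m+n _ _)

    module _ {v : Fin N} {τ : List (Fin N)} (ord : Ordering (v ∷ τ)) where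

      private
        |τ| : length τ ≡ n
        |τ| = suc-injective (ordering-length ord)

        extend : ∀ {ρ} → ρ ↭ τ → Ordering (v ∷ ρ)
        extend p = ↭-trans (prep v p) ord

        u a ā : ℕ
        u = perm∑ n (unsaturated ∘ (v ∷_)) τ
        a = perm∑ n (𝟙 ∘ centred v ∘ (v ∷_)) τ
        ā = perm∑ n (𝟙 ∘ not ∘ centred v ∘ (v ∷_)) τ

      Ω-unsaturated : Ω unsaturated ≡ N * u
      Ω-unsaturated = perm∑-rotation-invariant ord unsaturated unsaturated-rot

      Ω-centred : Ω (𝟙 ∘ centred v) ≡ N * a
      Ω-centred = perm∑-rotation-invariant ord (𝟙 ∘ centred v)
        (λ p → cong (λ h → 𝟙 (does (r ≤? h))) (hits-rot m (star 𝓕 v) p))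

      centred+uncentred : a + ā ≡ n !
      centred+uncentred = trans (sym (perm∑-+ n _ _ τ))
        (trans (perm∑-ext n τ λ ρ → 𝟙-not (centred v (v ∷ ρ))) (trans (perm∑-const n 1 τ |τ|) (*-identityʳ (n !))))

      -- An unsaturated ordering wastes at least one of the r arcs permitted by `hits≤r`, so a large
      -- family leaves few of them. Cancelling N passes from all orderings to those that begin with
      -- v.
      family-count : length 𝓕 * K + u ≤ n ! * r
      family-count = *-cancelˡ-≤ N (begin
        N * (length 𝓕 * K + u)               ≡⟨ *-distribˡ-+ N (length 𝓕 * K) u ⟩
        N * (length 𝓕 * K) + N * u           ≡⟨ cong₂ _+_ (sym (perm∑-hits m+r≡n uniform)) (sym Ω-unsaturated) ⟩
        Ω (hits m 𝓕) + Ω unsaturated         ≡⟨ sym (perm∑-+ N (hits m 𝓕) unsaturated (allFin N)) ⟩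
        Ω (λ σ → hits m 𝓕 σ + unsaturated σ) ≤⟨ perm∑-mono N (allFin N) |allFin| (λ σ → hits+unsaturated≤r) ⟩
        Ω (λ _ → r)                          ≡⟨ perm∑-const N r (allFin N) |allFin| ⟩
        N ! * r                              ≡⟨ *-assoc N (n !) r ⟩
        N * (n ! * r) ∎)
        where open ≤-Reasoning

      star-uniform : IsUniformFamily N r (star 𝓕 v)
      star-uniform = filter⁺ (v ∈?_) (proj₁ uniform) , AllP.filter⁺ (v ∈?_) (proj₂ uniform)

      star-count : r * a ≤ length (star 𝓕 v) * K
      star-count = begin
        r * a                                               ≡⟨ sym (perm∑-* n r _ τ) ⟩
        perm∑ n (λ ρ → r * 𝟙 (centred v (v ∷ ρ))) τ         ≤⟨ perm∑-mono n τ |τ| (λ ρ _ → centred-hits (r ≤? hits m (star 𝓕 v) (v ∷ ρ))) ⟩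
        perm∑ n (hits m (star 𝓕 v) ∘ (v ∷_)) τ              ≡⟨ *-cancelˡ-≡ _ _ N (trans
            (sym (perm∑-rotation-invariant ord (hits m (star 𝓕 v)) (hits-rot m (star 𝓕 v)))) (perm∑-hits m+r≡n star-uniform)) ⟩
        length (star 𝓕 v) * K ∎
        where
        open ≤-Reasoning
        centred-hits : ∀ {h} (d : Dec (r ≤ h)) → r * 𝟙 (does d) ≤ h
        centred-hits (yes r≤h) = ≤-trans (≤-reflexive (*-identityʳ r)) r≤h
        centred-hits (no _)    = ≤-trans (≤-reflexive (*-zeroʳ r)) z≤n

      -- By `hits-star-swapAt`, a transposition that leaves the orderings centred at v ends in an
      -- unsaturated one. The end of such a step is as uniformly distributed as its start, so at
      -- most `u` orderings leave at each p.
      centred-isoperimetry : 2 * (a * ā) ≤ n ! * (n * n * u)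
      centred-isoperimetry = isoperimetry n τ |τ| (centred v ∘ (v ∷_)) u λ p →
        ≤-trans (perm∑-mono n τ |τ| λ ρ q → 𝟙-product (r ≤? hits m (star 𝓕 v) (v ∷ ρ))
                  (r ≤? hits m (star 𝓕 v) (v ∷ swapAt p ρ)) (hits m 𝓕 (v ∷ swapAt p ρ) <? r)
                  λ sat h≮r → ≤-trans (≮⇒≥ h≮r) (hits-star-swapAt (extend q) sat p))
                (≤-reflexive (perm∑-swapAt n p (unsaturated ∘ (v ∷_)) τ))
        where
        𝟙-product : ∀ {P Q R : Set} (p : Dec P) (q : Dec Q) (b : Dec R) → (P → ¬ R → Q) →
          𝟙 (does p) * 𝟙 (not (does q)) ≤ 𝟙 (does b)
        𝟙-product (no _)  q       b       f = z≤n
        𝟙-product (yes p) (yes _) b       f = z≤n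
        𝟙-product (yes p) (no ¬q) (yes _) f = ≤-refl
        𝟙-product (yes p) (no ¬q) (no ¬b) f = contradiction (f p ¬b) ¬q

    ∃-order-from : ∀ (v : Fin N) → ∃ λ τ → Ordering (v ∷ τ)
    ∃-order-from v with ∈-∃++ (∈-allFin v)
    ... | xs , ys , eq = xs ++ ys , ↭-trans (↭-sym (shift v xs ys)) (subst (xs ++ v ∷ ys ↭_) (sym eq) ↭-refl)

    -- A saturated ordering has a centre, so the best of the N candidates receives at least the
    -- average.
    popular-centre : ∃ λ (v : Fin N) → N ! ≤ N * Ω (𝟙 ∘ centred v) + Ω unsaturated
    popular-centre with ≤-max-term fzero (tabulate fsuc) (λ v → Ω (𝟙 ∘ centred v))
    ... | v , le = v , (begin
      N !                                                                 ≡⟨ sym (*-identityʳ (N !)) ⟩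
      N ! * 1                                                             ≡⟨ sym (perm∑-const N 1 (allFin N) |allFin|) ⟩
      Ω (λ _ → 1)                                                         ≤⟨ perm∑-mono N (allFin N) |allFin| (λ σ → centred-or-unsaturated) ⟩
      Ω (λ σ → Σₗ (allFin N) (λ v → 𝟙 (centred v σ)) + unsaturated σ)     ≡⟨ perm∑-+ N (λ σ → Σₗ (allFin N) (λ v → 𝟙 (centred v σ))) unsaturated (allFin N) ⟩
      Ω (λ σ → Σₗ (allFin N) (λ v → 𝟙 (centred v σ))) + Ω unsaturated     ≡⟨ cong (_+ Ω unsaturated) (perm∑-Σₗ N (allFin N) (λ v σ → 𝟙 (centred v σ)) (allFin N)) ⟩
      Σₗ (allFin N) (λ v → Ω (𝟙 ∘ centred v)) + Ω unsaturated             ≤⟨ +-monoˡ-≤ _ le ⟩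
      length (allFin N) * Ω (𝟙 ∘ centred v) + Ω unsaturated               ≡⟨ cong (λ l → l * Ω (𝟙 ∘ centred v) + Ω unsaturated) |allFin| ⟩
      N * Ω (𝟙 ∘ centred v) + Ω unsaturated ∎)
      where open ≤-Reasoning

    -- C is the size of a full star, known here through the identity of `binomial-count`, and D
    -- bounds the deficiency of 𝓕. The condition 2 r D ≤ C leaves at most half of the orderings
    -- unsaturated, which gives the popular v a share of at least 1/(2N). Dividing the isoperimetric
    -- inequality by this share bounds the number `ā` of orderings not centred at v.
    stability : ∀ {C D} → K * C ≡ r * n ! → C ≤ length 𝓕 + D → 2 * (r * D) ≤ C →
      ∃ λ (v : Fin N) → C ≤ length (star 𝓕 v) + r * (N * N * N * D)
    stability {C} {D} KC≡rT C≤f+D 2rD≤C with popular-centre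
    ... | v , le with ∃-order-from v
    ...   | τ , ord = v , *-cancelˡ-≤ K {{K≢0}} (begin
      K * C                                 ≡⟨ KC≡rT ⟩
      r * T                                 ≡⟨ cong (r *_) (sym (centred+uncentred ord)) ⟩
      r * (a + ā)                           ≡⟨ *-distribˡ-+ r a ā ⟩
      r * a + r * ā                         ≤⟨ +-mono-≤ (star-count ord) (*-monoʳ-≤ r ā≤) ⟩
      fv * K + r * (N * N * N * (K * D))    ≡⟨ collect fv K r N D ⟩
      K * (fv + r * (N * N * N * D)) ∎)
      where
      open ≤-Reasoning
      T = n !
      fv = length (star 𝓕 v)
      u = perm∑ n (unsaturated ∘ (v ∷_)) τ
      a = perm∑ n (𝟙 ∘ centred v ∘ (v ∷_)) τ
      ā = perm∑ n (𝟙 ∘ not ∘ centred v ∘ (v ∷_)) τ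
      r≢0 = >-nonZero 0<r
      T≢0 = n !≢0
      K≢0 = m !* r !≢0
      collect : ∀ fv K r N D → fv * K + r * (N * N * N * (K * D)) ≡ K * (fv + r * (N * N * N * D))
      collect = solve-∀
      pull-r : ∀ r K D → r * (2 * (K * D)) ≡ K * (2 * (r * D))
      pull-r = solve-∀
      pull-T : ∀ N T n u → N * (T * (n * n * u)) ≡ T * (N * (n * n) * u)
      pull-T = solve-∀
      pull-N : ∀ N a ā → 2 * (N * a) * ā ≡ N * (2 * (a * ā))
      pull-N = solve-∀
      cube : ∀ N u → N * (N * N) * u ≡ N * N * N * u
      cube = solve-∀
      T≤Na+u : T ≤ N * a + u
      T≤Na+u = *-cancelˡ-≤ N (begin
        N * T                                   ≤⟨ le ⟩
        N * Ω (𝟙 ∘ centred v) + Ω unsaturated   ≡⟨ cong₂ (λ s t → N * s + t) (Ω-centred ord) (Ω-unsaturated ord) ⟩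
        N * (N * a) + N * u                     ≡⟨ sym (*-distribˡ-+ N (N * a) u) ⟩
        N * (N * a + u) ∎)
      u≤KD : u ≤ K * D
      u≤KD = +-cancelˡ-≤ (length 𝓕 * K) u (K * D) (begin
        length 𝓕 * K + u       ≤⟨ family-count ord ⟩
        T * r                  ≡⟨ trans (*-comm T r) (sym KC≡rT) ⟩
        K * C                  ≤⟨ *-monoʳ-≤ K C≤f+D ⟩
        K * (length 𝓕 + D)     ≡⟨ trans (*-distribˡ-+ K (length 𝓕) D) (cong (_+ K * D) (*-comm K (length 𝓕))) ⟩
        length 𝓕 * K + K * D ∎)
      2u≤T : 2 * u ≤ T
      2u≤T = *-cancelˡ-≤ r {{r≢0}} (begin
        r * (2 * u)          ≤⟨ *-monoʳ-≤ r (*-monoʳ-≤ 2 u≤KD) ⟩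
        r * (2 * (K * D))    ≡⟨ pull-r r K D ⟩
        K * (2 * (r * D))    ≤⟨ *-monoʳ-≤ K 2rD≤C ⟩
        K * C                ≡⟨ KC≡rT ⟩
        r * T ∎)
      T≤2Na : T ≤ 2 * (N * a)
      T≤2Na = +-cancelʳ-≤ T T _ (begin
        T + T                      ≡⟨ cong (T +_) (sym (+-identityʳ T)) ⟩
        2 * T                      ≤⟨ *-monoʳ-≤ 2 T≤Na+u ⟩
        2 * (N * a + u)            ≡⟨ *-distribˡ-+ 2 (N * a) u ⟩
        2 * (N * a) + 2 * u        ≤⟨ +-monoʳ-≤ (2 * (N * a)) 2u≤T ⟩
        2 * (N * a) + T ∎)
      ā≤ : ā ≤ N * N * N * (K * D)
      ā≤ = *-cancelˡ-≤ T {{T≢0}} (begin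
        T * ā                          ≤⟨ *-monoˡ-≤ ā T≤2Na ⟩
        2 * (N * a) * ā                ≡⟨ pull-N N a ā ⟩
        N * (2 * (a * ā))              ≤⟨ *-monoʳ-≤ N (centred-isoperimetry ord) ⟩
        N * (T * (n * n * u))          ≡⟨ pull-T N T n u ⟩
        T * (N * (n * n) * u)          ≤⟨ *-monoʳ-≤ T (*-mono-≤ (*-monoʳ-≤ N (*-mono-≤ (n≤1+n n) (n≤1+n n))) u≤KD) ⟩
        T * (N * (N * N) * (K * D))    ≡⟨ cong (T *_) (cube N (K * D)) ⟩
        T * (N * N * N * (K * D)) ∎)

  -- The arc count of a full star: each of the n! orderings beginning with its centre shows `suc r`
  -- of its members.
  binomial-count : ∀ {n m r} → m + suc r ≡ suc n → (m ! * suc r !) * (n C r) ≡ suc r * n !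
  binomial-count {n} {m} {r} eq = begin
    (m ! * suc r !) * (n C r)           ≡⟨ rearrange (m !) (suc r) (r !) (n C r) ⟩
    suc r * ((n C r) * (r ! * m !))       ≡⟨ cong (λ l → suc r * ((n C r) * (r ! * l !))) (sym n∸r≡m) ⟩
    suc r * ((n C r) * (r ! * (n ∸ r) !)) ≡⟨ cong (suc r *_) (trans (cong (_* (r ! * (n ∸ r) !)) (nCk≡n!/k![n-k]! r≤n)) (m/n*n≡m {{r !* (n ∸ r) !≢0}} (k![n∸k]!∣n! r≤n))) ⟩
    suc r * n ! ∎
    where
    open ≡-Reasoning
    m+r≡n : m + r ≡ n
    m+r≡n = suc-injective (trans (sym (+-suc m r)) eq)
    r≤n : r ≤ n
    r≤n = ≤-trans (m≤n+m r m) (≤-reflexive m+r≡n)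
    n∸r≡m : n ∸ r ≡ m
    n∸r≡m = trans (cong (_∸ r) (sym m+r≡n)) (m+n∸n≡m m r)
    rearrange : ∀ a s b c → (a * (s * b)) * c ≡ s * (c * (b * a))
    rearrange = solve-∀

-- Passage to rational bounds

open Cycles using (stability; binomial-count)

open import Data.Rational using (ℚ; 0ℚ; 1ℚ; _-_; _*_; _≤_; _<_)
import Data.Integer as ℤ
import Data.Integer.Properties as ℤ
import Data.Nat as ℕ
open import Data.Nat using (z≤n; s≤s) renaming (_+_ to _+ℕ_)
import Data.Nat.Properties as ℕ
open import Data.Nat.Tactic.RingSolver using (solve-∀)
open import Data.Product using (_,_; proj₁; proj₂)
open import Data.Rational using (*<*; _+_; -_; _/_; toℚᵘ; nonNegative)
open import Data.Rational.Properties
open import Data.Rational.Solver using (module +-*-Solver)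
import Data.Rational.Unnormalised as ℚᵘ
import Data.Rational.Unnormalised.Properties as ℚᵘ
open import Data.Sum using (inj₁; inj₂)
open import Relation.Binary.PropositionalEquality using (_≡_; refl; sym; trans; cong; cong₂; subst)

ℕtoℚᵘ : ℕ → ℚᵘ.ℚᵘ
ℕtoℚᵘ m = ℚᵘ.mkℚᵘ (ℤ.+ m) 0

toℚᵘ-ℕtoℚ : ∀ m → toℚᵘ (ℕtoℚ m) ℚᵘ.≃ ℕtoℚᵘ m
toℚᵘ-ℕtoℚ m = toℚᵘ-fromℚᵘ (ℕtoℚᵘ m)

ℕtoℚ-+ : ∀ a b → ℕtoℚ (a +ℕ b) ≡ ℕtoℚ a + ℕtoℚ b
ℕtoℚ-+ a b = toℚᵘ-injective (ℚᵘ.≃-trans (toℚᵘ-ℕtoℚ (a +ℕ b)) (ℚᵘ.≃-trans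
  (ℚᵘ.*≡* (cong (ℤ._* ℤ.+ 1) (trans (ℤ.pos-+ a b) (sym (cong₂ ℤ._+_ (ℤ.*-identityʳ (ℤ.+ a)) (ℤ.*-identityʳ (ℤ.+ b)))))))
  (ℚᵘ.≃-sym (ℚᵘ.≃-trans (toℚᵘ-homo-+ (ℕtoℚ a) (ℕtoℚ b)) (ℚᵘ.+-cong (toℚᵘ-ℕtoℚ a) (toℚᵘ-ℕtoℚ b))))))

ℕtoℚ-* : ∀ a b → ℕtoℚ (a *ℕ b) ≡ ℕtoℚ a * ℕtoℚ b
ℕtoℚ-* a b = toℚᵘ-injective (ℚᵘ.≃-trans (toℚᵘ-ℕtoℚ (a *ℕ b)) (ℚᵘ.≃-trans
  (ℚᵘ.*≡* (cong (ℤ._* ℤ.+ 1) (ℤ.pos-* a b)))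
  (ℚᵘ.≃-sym (ℚᵘ.≃-trans (toℚᵘ-homo-* (ℕtoℚ a) (ℕtoℚ b)) (ℚᵘ.*-cong (toℚᵘ-ℕtoℚ a) (toℚᵘ-ℕtoℚ b))))))

ℕtoℚ-inverse : ∀ m → (ℤ.+ 1 / suc m) * ℕtoℚ (suc m) ≡ 1ℚ
ℕtoℚ-inverse m = toℚᵘ-injective (ℚᵘ.≃-trans (toℚᵘ-homo-* (ℤ.+ 1 / suc m) (ℕtoℚ (suc m)))
  (ℚᵘ.≃-trans (ℚᵘ.*-cong (toℚᵘ-fromℚᵘ (ℚᵘ.mkℚᵘ (ℤ.+ 1) m)) (toℚᵘ-ℕtoℚ (suc m)))
    (ℚᵘ.*≡* (cong (λ z → ℤ.+ suc z) (lemma m)))))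
  where
  lemma : ∀ m → (m +ℕ 0) *ℕ 1 ≡ m *ℕ 1 +ℕ 0
  lemma = solve-∀

ℕtoℚ-mono : ∀ {a b} → a ≤ℕ b → ℕtoℚ a ≤ ℕtoℚ b
ℕtoℚ-mono {a} {b} a≤b = toℚᵘ-cancel-≤ (ℚᵘ.≤-respˡ-≃ (ℚᵘ.≃-sym (toℚᵘ-ℕtoℚ a)) (ℚᵘ.≤-respʳ-≃ (ℚᵘ.≃-sym (toℚᵘ-ℕtoℚ b))
  (ℚᵘ.*≤* (ℤ.*-monoʳ-≤-nonNeg (ℤ.+ 1) (ℤ.+≤+ a≤b)))))

ℕtoℚ-cancel : ∀ {a b} → ℕtoℚ a ≤ ℕtoℚ b → a ≤ℕ b
ℕtoℚ-cancel {a} {b} a≤b with ℚᵘ.≤-respˡ-≃ (toℚᵘ-ℕtoℚ a) (ℚᵘ.≤-respʳ-≃ (toℚᵘ-ℕtoℚ b) (toℚᵘ-mono-≤ a≤b))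
... | ℚᵘ.*≤* le = ℤ.drop‿+≤+ (ℤ.*-cancelʳ-≤-pos (ℤ.+ a) (ℤ.+ b) (ℤ.+ 1) le)

0≤ℕtoℚ : ∀ m → 0ℚ ≤ ℕtoℚ m
0≤ℕtoℚ m = ℕtoℚ-mono {0} {m} z≤n

*-monoʳ-≤ : ∀ {p q} c → 0ℚ ≤ c → p ≤ q → p * c ≤ q * c
*-monoʳ-≤ c 0≤c = *-monoʳ-≤-nonNeg c {{nonNegative 0≤c}}

0≤*ℕtoℚ : ∀ {p} m → 0ℚ ≤ p → 0ℚ ≤ p * ℕtoℚ m
0≤*ℕtoℚ {p} m 0≤p = subst (_≤ p * ℕtoℚ m) (*-zeroˡ (ℕtoℚ m)) (*-monoʳ-≤ (ℕtoℚ m) (0≤ℕtoℚ m) 0≤p)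

/ℕ-cancel : ∀ q d → 0 <ℕ d → (q /ℕ d) * ℕtoℚ d ≡ q
/ℕ-cancel q (suc d) _ = trans (*-assoc q _ _) (trans (cong (q *_) (ℕtoℚ-inverse d)) (*-identityʳ q))

*-cancel-ℕtoℚ : ∀ {p q} d → 0 <ℕ d → p * ℕtoℚ d ≤ q * ℕtoℚ d → p ≤ q
*-cancel-ℕtoℚ {p} {q} (suc d) _ = *-cancelʳ-≤-pos (ℕtoℚ (suc d)) {{normalize-pos (suc d) 1}}

0≤/ℕ : ∀ {q} d → 0 <ℕ d → 0ℚ ≤ q → 0ℚ ≤ q /ℕ d
0≤/ℕ {q} d 0<d 0≤q = *-cancel-ℕtoℚ d 0<d
  (subst (_≤ (q /ℕ d) * ℕtoℚ d) (sym (*-zeroˡ (ℕtoℚ d))) (subst (0ℚ ≤_) (sym (/ℕ-cancel q d 0<d)) 0≤q))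

≤-∸-bound : ∀ {c f δ} → 0ℚ ≤ δ → (1ℚ - δ) * ℕtoℚ c ≤ ℕtoℚ f → ℕtoℚ (c ∸ℕ f) ≤ δ * ℕtoℚ c
≤-∸-bound {c} {f} {δ} 0≤δ h with ℕ.≤-total c f
-- The truncated difference is 0 here, and 0 ≤ δ is what makes the right side nonnegative.
... | inj₁ c≤f = subst (λ d → ℕtoℚ d ≤ δ * ℕtoℚ c) (sym (ℕ.m≤n⇒m∸n≡0 c≤f)) (0≤*ℕtoℚ c 0≤δ)
... | inj₂ f≤c = begin
  D                                     ≡⟨ solve 3 (λ D F X → D := (F :+ D) :- X :+ (X :- F)) refl D F (δ * ℕtoℚ c) ⟩
  (F + D) - δ * ℕtoℚ c + (δ * ℕtoℚ c - F)   ≡⟨ cong (λ x → x - δ * ℕtoℚ c + (δ * ℕtoℚ c - F)) (trans (sym (ℕtoℚ-+ f (c ∸ℕ f))) (cong ℕtoℚ (ℕ.m+[n∸m]≡n f≤c))) ⟩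
  ℕtoℚ c - δ * ℕtoℚ c + (δ * ℕtoℚ c - F)    ≡⟨ solve 3 (λ x y z → x :- y :* x :+ (y :* x :- z) := (con 1ℚ :- y) :* x :+ (y :* x :- z)) refl (ℕtoℚ c) δ F ⟩
  (1ℚ - δ) * ℕtoℚ c + (δ * ℕtoℚ c - F)      ≤⟨ +-monoˡ-≤ (δ * ℕtoℚ c - F) h ⟩
  F + (δ * ℕtoℚ c - F)                    ≡⟨ solve 2 (λ F X → F :+ (X :- F) := X) refl F (δ * ℕtoℚ c) ⟩
  δ * ℕtoℚ c ∎
  where
  open ≤-Reasoning
  open +-*-Solver
  D = ℕtoℚ (c ∸ℕ f)
  F = ℕtoℚ f

<-from-density : ∀ {k n r} → k *ℕ r <ℕ (k ∸ℕ 1) *ℕ n → r <ℕ n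
<-from-density {suc k} {n} {r} lt = ℕ.*-cancelˡ-< k r n (ℕ.≤-<-trans (ℕ.m≤n+m (k *ℕ r) r) lt)

-- The density condition in terms of complements: k of them together are longer than the cycle.
<-co-density : ∀ {k n r} → k *ℕ r <ℕ (k ∸ℕ 1) *ℕ n → n <ℕ k *ℕ (n ∸ℕ r)
<-co-density {suc k} {n} {r} lt = ℕ.+-cancelʳ-< (suc k *ℕ r) _ _ (begin-strict
  n +ℕ suc k *ℕ r                     <⟨ ℕ.+-monoʳ-< n lt ⟩
  suc k *ℕ n                          ≡⟨ cong (suc k *ℕ_) (sym (ℕ.m∸n+n≡m (ℕ.<⇒≤ (<-from-density {suc k} lt)))) ⟩
  suc k *ℕ (n ∸ℕ r +ℕ r)              ≡⟨ ℕ.*-distribˡ-+ (suc k) (n ∸ℕ r) r ⟩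
  suc k *ℕ (n ∸ℕ r) +ℕ suc k *ℕ r ∎)
  where open ℕ.≤-Reasoning

module _ {k n r : ℕ} (density : k *ℕ suc r <ℕ (k ∸ℕ 1) *ℕ suc n)
         {𝓕 : List (Subset (suc n))} (uniform : IsUniformFamily (suc n) (suc r) 𝓕) (kwise : KWiseIntersecting k 𝓕)
         {ε : ℚ} (ε<1 : ε < 1ℚ) {δ : ℚ} (0≤δ : 0ℚ ≤ δ) (δ≤ : δ ≤ ε /ℕ (suc r *ℕ (suc n ^ℕ 4)))
         (large : (1ℚ - δ) * ℕtoℚ (n C r) ≤ ℕtoℚ (length 𝓕)) where

  private
    N R c D d : ℕ
    N = suc n
    R = suc r
    c = n C r
    D = c ∸ℕ length 𝓕
    d = R *ℕ (N ^ℕ 4)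

    R<N : R <ℕ N
    R<N = <-from-density {k} density

    m+R≡N : N ∸ℕ R +ℕ R ≡ N
    m+R≡N = ℕ.m∸n+n≡m (ℕ.<⇒≤ R<N)

    0<d : 0 <ℕ d
    0<d = ℕ.*-mono-≤ {1} {R} (s≤s z≤n) (ℕ.m^n>0 N 4)

    dD≤εc : ℕtoℚ (d *ℕ D) ≤ ε * ℕtoℚ c
    dD≤εc = begin
      ℕtoℚ (d *ℕ D)                              ≡⟨ trans (ℕtoℚ-* d D) (*-comm (ℕtoℚ d) (ℕtoℚ D)) ⟩
      ℕtoℚ D * ℕtoℚ d                            ≤⟨ *-monoʳ-≤ (ℕtoℚ d) (0≤ℕtoℚ d) (≤-∸-bound {c} {length 𝓕} 0≤δ large) ⟩
      δ * ℕtoℚ c * ℕtoℚ d                        ≤⟨ *-monoʳ-≤ (ℕtoℚ d) (0≤ℕtoℚ d) (*-monoʳ-≤ (ℕtoℚ c) (0≤ℕtoℚ c) δ≤) ⟩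
      (ε /ℕ d) * ℕtoℚ c * ℕtoℚ d                 ≡⟨ solve 3 (λ x y z → x :* y :* z := x :* z :* y) refl (ε /ℕ d) (ℕtoℚ c) (ℕtoℚ d) ⟩
      (ε /ℕ d) * ℕtoℚ d * ℕtoℚ c                 ≡⟨ cong (_* ℕtoℚ c) (/ℕ-cancel ε d 0<d) ⟩
      ε * ℕtoℚ c ∎
      where
      open ≤-Reasoning
      open +-*-Solver

    -- Since ε < 1, the product d D is at most c, and its factor N⁴ is at least 2 because 1 ≤ R < N.
    2RD≤c : 2 *ℕ (R *ℕ D) ≤ℕ c
    2RD≤c = ℕ.≤-trans 2RD≤dD (ℕtoℚ-cancel (≤-trans dD≤εc
      (subst (ε * ℕtoℚ c ≤_) (*-identityˡ (ℕtoℚ c)) (*-monoʳ-≤ (ℕtoℚ c) (0≤ℕtoℚ c) (<⇒≤ ε<1)))))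
      where
      open ℕ.≤-Reasoning
      rearrange : ∀ x y z → x *ℕ (y *ℕ z) ≡ y *ℕ x *ℕ z
      rearrange = solve-∀
      2≤N^4 : 2 ≤ℕ N ^ℕ 4
      2≤N^4 = ℕ.≤-trans (ℕ.≤-trans (s≤s (s≤s z≤n)) R<N) (ℕ.m≤m*n N (N ^ℕ 3) {{ℕ.>-nonZero (ℕ.m^n>0 N 3)}})
      2RD≤dD : 2 *ℕ (R *ℕ D) ≤ℕ d *ℕ D
      2RD≤dD = begin
        2 *ℕ (R *ℕ D)   ≡⟨ rearrange 2 R D ⟩
        R *ℕ 2 *ℕ D     ≤⟨ ℕ.*-monoˡ-≤ D (ℕ.*-monoʳ-≤ R 2≤N^4) ⟩
        d *ℕ D ∎

  rational-stability : ∃ λ (v : Fin N) → (1ℚ - (ε /ℕ N)) * ℕtoℚ c ≤ ℕtoℚ (length (star 𝓕 v))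
  rational-stability = v , (begin
    (1ℚ - e) * ℕtoℚ c                ≡⟨ solve 2 (λ x y → (con 1ℚ :- x) :* y := y :- x :* y) refl e (ℕtoℚ c) ⟩
    ℕtoℚ c - e * ℕtoℚ c              ≤⟨ +-monoˡ-≤ (- (e * ℕtoℚ c)) (ℕtoℚ-mono c≤fv+X) ⟩
    ℕtoℚ (fv +ℕ X) - e * ℕtoℚ c      ≡⟨ cong (_- e * ℕtoℚ c) (ℕtoℚ-+ fv X) ⟩
    ℕtoℚ fv + ℕtoℚ X - e * ℕtoℚ c    ≤⟨ +-monoˡ-≤ (- (e * ℕtoℚ c)) (+-monoʳ-≤ (ℕtoℚ fv) X≤ec) ⟩
    ℕtoℚ fv + e * ℕtoℚ c - e * ℕtoℚ c  ≡⟨ solve 2 (λ x y → x :+ y :- y := x) refl (ℕtoℚ fv) (e * ℕtoℚ c) ⟩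
    ℕtoℚ fv ∎)
    where
    open ≤-Reasoning
    open +-*-Solver
    popular : ∃ λ (v : Fin N) → c ≤ℕ length (star 𝓕 v) +ℕ R *ℕ (N *ℕ N *ℕ N *ℕ D)
    popular = stability m+R≡N (ℕ.m<n⇒0<n∸m R<N) (s≤s z≤n) (<-co-density {k} density) uniform kwise
      (binomial-count m+R≡N) (ℕ.m≤n+m∸n c (length 𝓕)) 2RD≤c
    v = proj₁ popular
    c≤fv+X = proj₂ popular
    e = ε /ℕ N
    fv = length (star 𝓕 v)
    X = R *ℕ (N *ℕ N *ℕ N *ℕ D)
    rearrange : ∀ R N D → R *ℕ (N *ℕ N *ℕ N *ℕ D) *ℕ N ≡ R *ℕ (N *ℕ (N *ℕ (N *ℕ (N *ℕ 1)))) *ℕ D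
    rearrange = solve-∀
    X≤ec : ℕtoℚ X ≤ e * ℕtoℚ c
    -- Multiplying the loss R N³ D by the N from ε / N gives d D, which is where the fourth power is
    -- used up.
    X≤ec = *-cancel-ℕtoℚ N (s≤s z≤n) (begin
      ℕtoℚ X * ℕtoℚ N           ≡⟨ trans (sym (ℕtoℚ-* X N)) (cong ℕtoℚ (rearrange R N D)) ⟩
      ℕtoℚ (d *ℕ D)             ≤⟨ dD≤εc ⟩
      ε * ℕtoℚ c                ≡⟨ cong (_* ℕtoℚ c) (sym (/ℕ-cancel ε N (s≤s z≤n))) ⟩
      e * ℕtoℚ N * ℕtoℚ c       ≡⟨ solve 3 (λ x y z → x :* y :* z := x :* z :* y) refl e (ℕtoℚ N) (ℕtoℚ c) ⟩
      e * ℕtoℚ c * ℕtoℚ N ∎)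

theorem1p3 : (k n r : ℕ) → 2 ≤ℕ k → 1 ≤ℕ n → 1 <ℕ r → k *ℕ r <ℕ (k ∸ℕ 1) *ℕ n →
    (𝓕 : List (Subset n)) → IsUniformFamily n r 𝓕 → KWiseIntersecting k 𝓕 →
    (ε : ℚ) → 0ℚ ≤ ε → ε < 1ℚ →
    (Σ ℚ λ δ → 0ℚ ≤ δ × δ < 1ℚ ×
    ((1ℚ - δ) * ℕtoℚ ((n ∸ℕ 1) C (r ∸ℕ 1)) ≤ ℕtoℚ (length 𝓕) →
    ∃ λ (v : Fin n) →
    (1ℚ - (ε /ℕ n)) * ℕtoℚ ((n ∸ℕ 1) C (r ∸ℕ 1)) ≤ ℕtoℚ (length (star 𝓕 v))))
    × ((δ : ℚ) → 0ℚ ≤ δ → δ ≤ ε /ℕ (r *ℕ (n ^ℕ 4)) →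
    (1ℚ - δ) * ℕtoℚ ((n ∸ℕ 1) C (r ∸ℕ 1)) ≤ ℕtoℚ (length 𝓕) →
    ∃ λ (v : Fin n) →
    (1ℚ - (ε /ℕ n)) * ℕtoℚ ((n ∸ℕ 1) C (r ∸ℕ 1)) ≤ ℕtoℚ (length (star 𝓕 v)))
theorem1p3 k (suc n) (suc r) _ _ (s≤s _) density 𝓕 uniform kwise ε 0≤ε ε<1 =
  -- The witness δ = 0 lies below the explicit bound because 0 ≤ ε; the second component treats
  -- every δ up to that bound.
  (0ℚ , ≤-refl , *<* (ℤ.+<+ (s≤s z≤n)) ,
    rational-stability {k} density uniform kwise ε<1 ≤-refl
      (0≤/ℕ (suc r *ℕ (suc n ^ℕ 4)) (ℕ.*-mono-≤ {1} {suc r} (s≤s z≤n) (ℕ.m^n>0 (suc n) 4)) 0≤ε)) ,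
  λ δ 0≤δ δ≤ → rational-stability {k} density uniform kwise ε<1 0≤δ δ≤
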